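{- Let $(X,\mathcal F)$ be a (finite) hypergraph with maximum degree $\Delta$, and let $f$ be a positive integer. Let $\tau_f$ denote the $f$-fold transversal number and $\tau^{\ast}$ the fractional transversal number of $(X,\mathcal F)$. Then $$\tau_f\leq 3.153\,\tau^{\ast}\max\{\ln \Delta, f\}.$$
   Context: A hypergraph is a pair $(X,\mathcal F)$, where $X$ is a finite set (the vertices) and $\mathcal F\subseteq 2^X$ is a family of subsets of $X$ (the edges). It is tacitly assumed that $\mathcal F$ is nonempty and that every edge is nonempty. The maximum degree $\Delta$ is the maximum number of edges a vertex is contained in. An $f$-fold transversal of $(X,\mathcal F)$ is a multiset $A$ of elements of $X$ such that each $F\in\mathcal F$ contains at least $f$ elements of $A$, counted with multiplicity. The $f$-fold transversal number $\tau_f$ is the minimum cardinality (with multiplicity) of an $f$-fold transversal. A fractional transversal is a function $w:X\to[0,1]$ with $\sum_{x\in F}w(x)\ge 1$ for all $F\in\mathcal F$; the fractional transversal number is $\tau^{\ast}=\inf\{\sum_{x\in X}w(x) : w \text{ is a fractional transversal}\}$. -}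

module Defs where

open import Algebra.Bundles using (CommutativeMonoid)
open import Algebra.Properties.CommutativeMonoid.Sum using () renaming (sum to sumOf)
open import Algebra.Properties.CommutativeSemigroup using (interchange)
open import Data.Bool.Base using (if_then_else_)
open import Data.Fin.Base using (Fin)
open import Data.Fin.Subset using (Subset; Nonempty)
open import Data.Fin.Subset.Properties using (_∈?_)
open import Data.Integer.Base using (+_)
open import Data.List.Base using (List; []; length; filter)
open import Data.List.Relation.Unary.All using (All)
open import Data.List.Relation.Unary.Unique.Propositional using (Unique)
open import Data.Nat.Base as ℕ using (ℕ; zero; suc; _!)
import Data.Nat.Properties as ℕ
open import Data.Product.Base using (∃; ∃-syntax; _×_; _,_; proj₁; proj₂)
open import Data.Rational.Base as ℚ using (ℚ; 0ℚ; 1ℚ; ½; _/_; ∣_∣; Positive)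
import Data.Rational.Properties as ℚ
open import Data.Rational.Solver using (module +-*-Solver)
open import Data.Sum.Base using (inj₁; inj₂)
import Data.Vec.Functional as Vector
open import Relation.Binary.PropositionalEquality
  using (_≡_; _≢_; refl; sym; trans; cong; cong₂; subst)
open import Relation.Nullary.Decidable using (does)

------------------------------------------------------------------------
-- Real numbers, as Cauchy sequences of rationals.  Equality of reals is
-- `x ≤ y × y ≤ x`, not `_≡_`.

IsCauchy : (ℕ → ℚ) → Set
IsCauchy x = ∀ ε → 0ℚ ℚ.< ε →
  ∃[ N ] (∀ m n → N ℕ.≤ m → N ℕ.≤ n → ∣ x m ℚ.- x n ∣ ℚ.≤ ε)

record ℝ : Set where
  constructor mkℝ
  field
    seq    : ℕ → ℚ
    cauchy : IsCauchy seq

open ℝ public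

infix 4 _≤_

_≤_ : ℝ → ℝ → Set
x ≤ y = ∀ ε → 0ℚ ℚ.< ε → ∃[ N ] (∀ n → N ℕ.≤ n → seq x n ℚ.≤ seq y n ℚ.+ ε)

private
  half-pos : ∀ {ε} → 0ℚ ℚ.< ε → 0ℚ ℚ.< ½ ℚ.* ε
  half-pos {ε} ε>0 =
    subst (ℚ._< ½ ℚ.* ε) (ℚ.*-zeroʳ ½) (ℚ.*-monoʳ-<-pos ½ ε>0)

  half+half : ∀ ε → ½ ℚ.* ε ℚ.+ ½ ℚ.* ε ≡ ε
  half+half ε = trans (sym (ℚ.*-distribʳ-+ ε ½ ½)) (ℚ.*-identityˡ ε)

  p≤∣p∣ : ∀ p → p ℚ.≤ ∣ p ∣
  p≤∣p∣ p with ℚ.≤-total 0ℚ p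
  ... | inj₁ 0≤p = ℚ.≤-reflexive (sym (ℚ.0≤p⇒∣p∣≡p 0≤p))
  ... | inj₂ p≤0 = ℚ.≤-trans p≤0 (ℚ.0≤∣p∣ p)

  ∣p∣≤ : ∀ p {ε} → p ℚ.≤ ε → ℚ.- p ℚ.≤ ε → ∣ p ∣ ℚ.≤ ε
  ∣p∣≤ p p≤ε -p≤ε with ℚ.∣p∣≡p∨∣p∣≡-p p
  ... | inj₁ eq = ℚ.≤-trans (ℚ.≤-reflexive eq) p≤ε
  ... | inj₂ eq = ℚ.≤-trans (ℚ.≤-reflexive eq) -p≤ε

  neg-sub : ∀ p q → ℚ.- (p ℚ.- q) ≡ q ℚ.- p
  neg-sub = solve 2 (λ p q → :- (p :- q) := q :- p) refl
    where open +-*-Solver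

  ∣p-q∣≡∣q-p∣ : ∀ p q → ∣ p ℚ.- q ∣ ≡ ∣ q ℚ.- p ∣
  ∣p-q∣≡∣q-p∣ p q = trans (sym (ℚ.∣-p∣≡∣p∣ (p ℚ.- q))) (cong ∣_∣ (neg-sub p q))

  close⇒≤ : ∀ p q {ε} → ∣ p ℚ.- q ∣ ℚ.≤ ε → p ℚ.≤ q ℚ.+ ε
  close⇒≤ p q {ε} h = begin
    p                   ≡⟨ split p q ⟩
    q ℚ.+ (p ℚ.- q)     ≤⟨ ℚ.+-monoʳ-≤ q (ℚ.≤-trans (p≤∣p∣ (p ℚ.- q)) h) ⟩
    q ℚ.+ ε             ∎
    where
    open ℚ.≤-Reasoning
    split : ∀ p q → p ≡ q ℚ.+ (p ℚ.- q)
    split = solve 2 (λ p q → p := q :+ (p :- q)) refl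
      where open +-*-Solver

  ≤⇒sub≤ : ∀ p q {ε} → p ℚ.≤ q ℚ.+ ε → p ℚ.- q ℚ.≤ ε
  ≤⇒sub≤ p q {ε} h = begin
    p ℚ.- q             ≤⟨ ℚ.+-monoˡ-≤ (ℚ.- q) h ⟩
    q ℚ.+ ε ℚ.- q       ≡⟨ cancel q ε ⟩
    ε                   ∎
    where
    open ℚ.≤-Reasoning
    cancel : ∀ q ε → q ℚ.+ ε ℚ.- q ≡ ε
    cancel = solve 2 (λ q ε → q :+ ε :- q := ε) refl
      where open +-*-Solver

  ≤⇒close : ∀ p q {ε} → p ℚ.≤ q ℚ.+ ε → q ℚ.≤ p ℚ.+ ε → ∣ p ℚ.- q ∣ ℚ.≤ ε
  ≤⇒close p q {ε} h k = ∣p∣≤ (p ℚ.- q) (≤⇒sub≤ p q h)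
    (subst (ℚ._≤ ε) (sym (neg-sub p q)) (≤⇒sub≤ q p k))

  -- A modulus working for two Cauchy sequences at once.
  both : ∀ x y → IsCauchy x → IsCauchy y → ∀ ε δ → 0ℚ ℚ.< ε → 0ℚ ℚ.< δ →
    ∃[ N ] (∀ m n → N ℕ.≤ m → N ℕ.≤ n →
      ∣ x m ℚ.- x n ∣ ℚ.≤ ε × ∣ y m ℚ.- y n ∣ ℚ.≤ δ)
  both x y cx cy ε δ ε>0 δ>0 with cx ε ε>0 | cy δ δ>0
  ... | M , hM | N , hN = M ℕ.⊔ N , λ m n p q →
    hM m n (ℕ.≤-trans (ℕ.m≤m⊔n M N) p) (ℕ.≤-trans (ℕ.m≤m⊔n M N) q) ,
    hN m n (ℕ.≤-trans (ℕ.m≤n⊔m M N) p) (ℕ.≤-trans (ℕ.m≤n⊔m M N) q)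

  -- A Cauchy sequence is eventually bounded.
  bounded : ∀ x → IsCauchy x →
    ∃[ B ] 0ℚ ℚ.< B × ∃[ N ] (∀ n → N ℕ.≤ n → ∣ x n ∣ ℚ.≤ B)
  bounded x cx with cx 1ℚ (ℚ.positive⁻¹ 1ℚ)
  ... | N , h = ∣ x N ∣ ℚ.+ 1ℚ , pos , N , bound
    where
    pos : 0ℚ ℚ.< ∣ x N ∣ ℚ.+ 1ℚ
    pos = ℚ.+-mono-≤-< (ℚ.0≤∣p∣ (x N)) (ℚ.positive⁻¹ 1ℚ)
    split : ∀ p q → p ≡ q ℚ.+ (p ℚ.- q)
    split = solve 2 (λ p q → p := q :+ (p :- q)) refl
      where open +-*-Solver
    bound : ∀ n → N ℕ.≤ n → ∣ x n ∣ ℚ.≤ ∣ x N ∣ ℚ.+ 1ℚ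
    bound n N≤n = begin
      ∣ x n ∣                         ≡⟨ cong ∣_∣ (split (x n) (x N)) ⟩
      ∣ x N ℚ.+ (x n ℚ.- x N) ∣       ≤⟨ ℚ.∣p+q∣≤∣p∣+∣q∣ (x N) (x n ℚ.- x N) ⟩
      ∣ x N ∣ ℚ.+ ∣ x n ℚ.- x N ∣     ≤⟨ ℚ.+-monoʳ-≤ ∣ x N ∣ (h n N N≤n ℕ.≤-refl) ⟩
      ∣ x N ∣ ℚ.+ 1ℚ                  ∎
      where open ℚ.≤-Reasoning

  -- A positive δ with B δ = ε / 2.
  shrink : ∀ B ε → 0ℚ ℚ.< B → 0ℚ ℚ.< ε → ∃[ δ ] 0ℚ ℚ.< δ × B ℚ.* δ ≡ ½ ℚ.* ε
  shrink B ε B>0 ε>0 = B⁻¹ ℚ.* (½ ℚ.* ε) , δ>0 , eq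
    where
    instance
      B-pos : Positive B
      B-pos = ℚ.positive B>0
      B-nonZero : ℚ.NonZero B
      B-nonZero = ℚ.pos⇒nonZero B
    B⁻¹ : ℚ
    B⁻¹ = ℚ.1/ B
    instance
      B⁻¹-pos : Positive B⁻¹
      B⁻¹-pos = ℚ.1/pos⇒pos B
    δ>0 : 0ℚ ℚ.< B⁻¹ ℚ.* (½ ℚ.* ε)
    δ>0 = subst (ℚ._< B⁻¹ ℚ.* (½ ℚ.* ε)) (ℚ.*-zeroʳ B⁻¹)
      (ℚ.*-monoʳ-<-pos B⁻¹ (half-pos ε>0))
    eq : B ℚ.* (B⁻¹ ℚ.* (½ ℚ.* ε)) ≡ ½ ℚ.* ε
    eq = trans (sym (ℚ.*-assoc B B⁻¹ (½ ℚ.* ε)))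
      (trans (cong (ℚ._* (½ ℚ.* ε)) (ℚ.*-inverseʳ B)) (ℚ.*-identityˡ (½ ℚ.* ε)))

  *-bound : ∀ p q r s → ∣ p ∣ ℚ.≤ r → ∣ q ∣ ℚ.≤ s → ∣ p ℚ.* q ∣ ℚ.≤ r ℚ.* s
  *-bound p q r s p≤r q≤s = begin
    ∣ p ℚ.* q ∣         ≡⟨ ℚ.∣p*q∣≡∣p∣*∣q∣ p q ⟩
    ∣ p ∣ ℚ.* ∣ q ∣     ≤⟨ ℚ.*-monoˡ-≤-nonNeg ∣ p ∣ {{ℚ.∣-∣-nonNeg p}} q≤s ⟩
    ∣ p ∣ ℚ.* s         ≤⟨ ℚ.*-monoʳ-≤-nonNeg s {{ℚ.nonNegative (ℚ.≤-trans (ℚ.0≤∣p∣ q) q≤s)}} p≤r ⟩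
    r ℚ.* s             ∎
    where open ℚ.≤-Reasoning

  +-cauchy : ∀ x y → IsCauchy x → IsCauchy y → IsCauchy (λ n → x n ℚ.+ y n)
  +-cauchy x y cx cy ε ε>0
    with both x y cx cy (½ ℚ.* ε) (½ ℚ.* ε) (half-pos ε>0) (half-pos ε>0)
  ... | N , h = N , λ m n p q → begin
      ∣ x m ℚ.+ y m ℚ.- (x n ℚ.+ y n) ∣
        ≡⟨ cong ∣_∣ (regroup (x m) (y m) (x n) (y n)) ⟩
      ∣ (x m ℚ.- x n) ℚ.+ (y m ℚ.- y n) ∣
        ≤⟨ ℚ.∣p+q∣≤∣p∣+∣q∣ (x m ℚ.- x n) (y m ℚ.- y n) ⟩
      ∣ x m ℚ.- x n ∣ ℚ.+ ∣ y m ℚ.- y n ∣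
        ≤⟨ ℚ.+-mono-≤ (proj₁ (h m n p q)) (proj₂ (h m n p q)) ⟩
      ½ ℚ.* ε ℚ.+ ½ ℚ.* ε
        ≡⟨ half+half ε ⟩
      ε ∎
    where
    open ℚ.≤-Reasoning
    regroup : ∀ a b c d → a ℚ.+ b ℚ.- (c ℚ.+ d) ≡ (a ℚ.- c) ℚ.+ (b ℚ.- d)
    regroup a b c d = trans (cong (λ h → a ℚ.+ b ℚ.+ h) (ℚ.neg-distrib-+ c d))
      (interchange (CommutativeMonoid.commutativeSemigroup ℚ.+-0-commutativeMonoid)
        a b (ℚ.- c) (ℚ.- d))

  *-close : ∀ a b c d B C δ η →
    ∣ a ∣ ℚ.≤ B → ∣ d ∣ ℚ.≤ C → ∣ a ℚ.- c ∣ ℚ.≤ δ → ∣ b ℚ.- d ∣ ℚ.≤ η →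
    ∣ a ℚ.* b ℚ.- c ℚ.* d ∣ ℚ.≤ B ℚ.* η ℚ.+ C ℚ.* δ
  *-close a b c d B C δ η ha hd hac hbd = begin
    ∣ a ℚ.* b ℚ.- c ℚ.* d ∣
      ≡⟨ cong ∣_∣ regroup ⟩
    ∣ a ℚ.* (b ℚ.- d) ℚ.+ d ℚ.* (a ℚ.- c) ∣
      ≤⟨ ℚ.∣p+q∣≤∣p∣+∣q∣ (a ℚ.* (b ℚ.- d)) (d ℚ.* (a ℚ.- c)) ⟩
    ∣ a ℚ.* (b ℚ.- d) ∣ ℚ.+ ∣ d ℚ.* (a ℚ.- c) ∣
      ≤⟨ ℚ.+-mono-≤ (*-bound a (b ℚ.- d) B η ha hbd) (*-bound d (a ℚ.- c) C δ hd hac) ⟩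
    B ℚ.* η ℚ.+ C ℚ.* δ ∎
    where
    open ℚ.≤-Reasoning
    telescope : ∀ p q r → p ℚ.- r ≡ (p ℚ.- q) ℚ.+ (q ℚ.- r)
    telescope = solve 3 (λ p q r → p :- r := (p :- q) :+ (q :- r)) refl
      where open +-*-Solver
    factor : ∀ p q r → p ℚ.* q ℚ.- p ℚ.* r ≡ p ℚ.* (q ℚ.- r)
    factor p q r = trans (cong (λ h → p ℚ.* q ℚ.+ h) (ℚ.neg-distribʳ-* p r))
      (sym (ℚ.*-distribˡ-+ p q (ℚ.- r)))
    regroup : a ℚ.* b ℚ.- c ℚ.* d ≡ a ℚ.* (b ℚ.- d) ℚ.+ d ℚ.* (a ℚ.- c)
    regroup = trans (telescope (a ℚ.* b) (a ℚ.* d) (c ℚ.* d))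
      (cong₂ ℚ._+_ (factor a b d)
        (trans (cong₂ (λ h k → h ℚ.- k) (ℚ.*-comm a d) (ℚ.*-comm c d)) (factor d a c)))

  *-cauchy : ∀ x y → IsCauchy x → IsCauchy y → IsCauchy (λ n → x n ℚ.* y n)
  *-cauchy x y cx cy ε ε>0 =
    let B , B>0 , K , hB = bounded x cx
        C , C>0 , L , hC = bounded y cy
        δ , δ>0 , Cδ = shrink C ε C>0 ε>0
        η , η>0 , Bη = shrink B ε B>0 ε>0
        N , h = both x y cx cy δ η δ>0 η>0
    in N ℕ.⊔ (K ℕ.⊔ L) , λ m n p q →
      let hmn = h m n (ℕ.m⊔n≤o⇒m≤o N (K ℕ.⊔ L) p) (ℕ.m⊔n≤o⇒m≤o N (K ℕ.⊔ L) q)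
          K≤m = ℕ.m⊔n≤o⇒m≤o K L (ℕ.m⊔n≤o⇒n≤o N (K ℕ.⊔ L) p)
          L≤n = ℕ.m⊔n≤o⇒n≤o K L (ℕ.m⊔n≤o⇒n≤o N (K ℕ.⊔ L) q)
      in ℚ.≤-trans
        (*-close (x m) (y m) (x n) (y n) B C δ η
          (hB m K≤m) (hC n L≤n) (proj₁ hmn) (proj₂ hmn))
        (ℚ.≤-reflexive (trans (cong₂ ℚ._+_ Bη Cδ) (half+half ε)))

  ⊔-cauchy : ∀ x y → IsCauchy x → IsCauchy y → IsCauchy (λ n → x n ℚ.⊔ y n)
  ⊔-cauchy x y cx cy ε ε>0 with both x y cx cy ε ε ε>0 ε>0
  ... | N , h = N , λ m n p q →
      ≤⇒close (x m ℚ.⊔ y m) (x n ℚ.⊔ y n) (side m n p q) (side n m q p)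
    where
    side : ∀ m n → N ℕ.≤ m → N ℕ.≤ n → x m ℚ.⊔ y m ℚ.≤ (x n ℚ.⊔ y n) ℚ.+ ε
    side m n p q = ℚ.⊔-lub
      (ℚ.≤-trans (close⇒≤ (x m) (x n) (proj₁ (h m n p q)))
                 (ℚ.+-monoˡ-≤ ε (ℚ.p≤p⊔q (x n) (y n))))
      (ℚ.≤-trans (close⇒≤ (y m) (y n) (proj₂ (h m n p q)))
                 (ℚ.+-monoˡ-≤ ε (ℚ.p≤q⊔p (x n) (y n))))

fromℚ : ℚ → ℝ
fromℚ q = mkℝ (λ _ → q) λ ε ε>0 → 0 , λ _ _ _ _ →
  subst (ℚ._≤ ε) (cong ∣_∣ (sym (ℚ.+-inverseʳ q))) (ℚ.<⇒≤ ε>0)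

fromℕ : ℕ → ℝ
fromℕ k = fromℚ (+ k / 1)

0ℝ 1ℝ : ℝ
0ℝ = fromℚ 0ℚ
1ℝ = fromℚ 1ℚ

infixl 6 _+_ _⊔_
infixl 7 _*_
infixr 8 _^_

_+_ _*_ _⊔_ : ℝ → ℝ → ℝ
x + y = mkℝ (λ n → seq x n ℚ.+ seq y n) (+-cauchy (seq x) (seq y) (cauchy x) (cauchy y))
x * y = mkℝ (λ n → seq x n ℚ.* seq y n) (*-cauchy (seq x) (seq y) (cauchy x) (cauchy y))
x ⊔ y = mkℝ (λ n → seq x n ℚ.⊔ seq y n) (⊔-cauchy (seq x) (seq y) (cauchy x) (cauchy y))

_^_ : ℝ → ℕ → ℝ
x ^ zero  = 1ℝ
x ^ suc k = x * x ^ k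

------------------------------------------------------------------------
-- The natural logarithm, as the inverse of exp y = Σ yᵏ / k!

ConvergesTo : (ℕ → ℝ) → ℝ → Set
ConvergesTo s z = ∀ ε → 0ℚ ℚ.< ε →
  ∃[ N ] (∀ n → N ℕ.≤ n → s n ≤ z + fromℚ ε × z ≤ s n + fromℚ ε)

1/_! : ℕ → ℚ
1/ k ! = _/_ (+ 1) (k !) {{k ℕ.!≢0}}

expPartialSum : ℝ → ℕ → ℝ
expPartialSum y zero    = 0ℝ
expPartialSum y (suc n) = expPartialSum y n + y ^ n * fromℚ (1/ n !)

IsExp : ℝ → ℝ → Set
IsExp y z = ConvergesTo (expPartialSum y) z

IsLn : ℝ → ℝ → Set
IsLn z y = IsExp y z

------------------------------------------------------------------------
-- Hypergraphs on the vertex set Fin n.  `distinct` makes the list of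
-- edges a set of subsets, so that degrees count each edge once.

record Hypergraph (n : ℕ) : Set where
  field
    edges         : List (Subset n)
    distinct      : Unique edges
    edges≢[]      : edges ≢ []
    edgesNonempty : All Nonempty edges

open Hypergraph public

degree : ∀ {n} → Hypergraph n → Fin n → ℕ
degree H x = length (filter (x ∈?_) (edges H))

maxDegree : ∀ {n} → Hypergraph n → ℕ
maxDegree H = Vector.foldr ℕ._⊔_ 0 (degree H)

sumℕ : ∀ {n} → (Fin n → ℕ) → ℕ
sumℕ = sumOf ℕ.+-0-commutativeMonoid

sumℝ : ∀ {n} → (Fin n → ℝ) → ℝ
sumℝ = Vector.foldr _+_ 0ℝ

sumℕ-over : ∀ {n} → Subset n → (Fin n → ℕ) → ℕ
sumℕ-over F a = sumℕ (λ x → if does (x ∈? F) then a x else 0)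

sumℝ-over : ∀ {n} → Subset n → (Fin n → ℝ) → ℝ
sumℝ-over F w = sumℝ (λ x → if does (x ∈? F) then w x else 0ℝ)

-- A multiset of vertices is given by its multiplicity function.
IsFoldTransversal : ∀ {n} → Hypergraph n → ℕ → (Fin n → ℕ) → Set
IsFoldTransversal H f A = All (λ F → f ℕ.≤ sumℕ-over F A) (edges H)

IsFoldTransversalNumber : ∀ {n} → Hypergraph n → ℕ → ℕ → Set
IsFoldTransversalNumber H f τ =
  (∃[ A ] IsFoldTransversal H f A × sumℕ A ≡ τ) ×
  (∀ A → IsFoldTransversal H f A → τ ℕ.≤ sumℕ A)

IsFractionalTransversal : ∀ {n} → Hypergraph n → (Fin n → ℝ) → Set
IsFractionalTransversal H w =
  (∀ x → 0ℝ ≤ w x × w x ≤ 1ℝ) ×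
  All (λ F → 1ℝ ≤ sumℝ-over F w) (edges H)

-- τ* is the greatest lower bound of the total weights.
IsFractionalTransversalNumber : ∀ {n} → Hypergraph n → ℝ → Set
IsFractionalTransversalNumber H τ* =
  (∀ w → IsFractionalTransversal H w → τ* ≤ sumℝ w) ×
  (∀ b → (∀ w → IsFractionalTransversal H w → b ≤ sumℝ w) → b ≤ τ*)

{-# OPTIONS --safe #-}

-- Let w be a (rational) fractional transversal of total weight W.  Give an edge still lacking
-- d > 0 elements the weight 3^(d-1), and let Φ be the sum of these weights.  Each missing element
-- can be supplied separately, so a multiset A extends to an f-fold transversal of size at most
-- |A| + Φ(A).  Choosing a vertex with probability proportional to w shrinks Φ on average by the
-- factor 1 - p, where p = 2/(3W), so greedily τ_f ≤ m + (1 - p)^m Φ(∅) for all m, with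
-- Φ(∅) ≤ 3^(f-1) Δ W; by convexity the same holds for fractional m.  As 3 ≤ e^(11/10), taking
-- p m ≈ M + (11/10)(f - 1) for M = max {ln Δ, f} makes the second term about W, and
-- τ_f ≤ (3/2) W (M + (11/10) f) ≤ 3.15 W M.
-- The margin between 3.15 and 3.153 absorbs the passage from rational approximations to reals.
module Submission where

import Defs

open import Data.Bool.Base using (true; false; if_then_else_)
open import Data.Empty using (⊥-elim)
open import Data.Fin.Base using (Fin; zero; suc)
import Data.Fin.Properties as Fin
open import Data.Fin.Subset using (Subset; Nonempty)
open import Data.Fin.Subset.Properties using (_∈?_)
open import Data.Integer.Base as ℤ using (+_)
import Data.Integer.Properties as ℤ
open import Data.List.Base using (List; []; _∷_; length; filter)
open import Data.List.Relation.Unary.All as All using (All; []; _∷_)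
open import Data.Nat.Base as ℕ using (ℕ; zero; suc)
import Data.Nat.DivMod as ℕ
import Data.Nat.Properties as ℕ
open import Data.Product.Base using (∃-syntax; _×_; _,_; proj₁; proj₂)
open import Data.Sum.Base using (_⊎_; inj₁; inj₂)
open import Data.Unit.Base using (tt)
import Data.Vec.Functional as Vector
open import Relation.Binary.PropositionalEquality
  using (_≡_; _≢_; refl; sym; trans; cong; cong₂; subst; module ≡-Reasoning)
open import Relation.Nullary.Decidable
  using (Dec; yes; no; does; toWitness; toWitnessFalse; dec-true)

-- Rational arithmetic: embedded naturals, inequalities, powers and rounding.

module Arithmetic where
  open import Data.Rational.Base
  open import Data.Rational.Properties
  open import Data.Rational.Solver using (module +-*-Solver)
  open +-*-Solver
  open import Data.Rational.Unnormalised.Base as ℚᵘ using (mkℚᵘ; *≡*; *≤*)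
  import Data.Rational.Unnormalised.Properties as ℚᵘ
  open import Algebra.Bundles using (CommutativeRing)
  open CommutativeRing +-*-commutativeRing using (semiring)
  open import Algebra.Properties.Semiring.Exp semiring public
    using (_^_; ^-homo-*; ^-assocʳ)

  ι : ℕ → ℚ
  ι n = + n / 1

  ι-+ : ∀ m n → ι (m ℕ.+ n) ≡ ι m + ι n
  -- In unnormalised rationals no gcd intervenes, and the claim becomes an integer identity.
  ι-+ m n = toℚᵘ-injective (begin
    toℚᵘ (ι (m ℕ.+ n))              ≈⟨ toℚᵘ-fromℚᵘ (mkℚᵘ (+ (m ℕ.+ n)) 0) ⟩
    mkℚᵘ (+ (m ℕ.+ n)) 0            ≈⟨ *≡* (cong (ℤ._* + 1) (trans (ℤ.pos-+ m n) (sym (cong₂ ℤ._+_ (ℤ.*-identityʳ (+ m)) (ℤ.*-identityʳ (+ n)))))) ⟩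
    mkℚᵘ (+ m) 0 ℚᵘ.+ mkℚᵘ (+ n) 0  ≈⟨ ℚᵘ.+-cong (toℚᵘ-fromℚᵘ (mkℚᵘ (+ m) 0)) (toℚᵘ-fromℚᵘ (mkℚᵘ (+ n) 0)) ⟨
    toℚᵘ (ι m) ℚᵘ.+ toℚᵘ (ι n)      ≈⟨ toℚᵘ-homo-+ (ι m) (ι n) ⟨
    toℚᵘ (ι m + ι n)                ∎)
    where open ℚᵘ.≃-Reasoning

  ι-* : ∀ m n → ι (m ℕ.* n) ≡ ι m * ι n
  ι-* m n = toℚᵘ-injective (begin
    toℚᵘ (ι (m ℕ.* n))              ≈⟨ toℚᵘ-fromℚᵘ (mkℚᵘ (+ (m ℕ.* n)) 0) ⟩
    mkℚᵘ (+ (m ℕ.* n)) 0            ≈⟨ *≡* (cong (ℤ._* + 1) (ℤ.pos-* m n)) ⟩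
    mkℚᵘ (+ m) 0 ℚᵘ.* mkℚᵘ (+ n) 0  ≈⟨ ℚᵘ.*-cong (toℚᵘ-fromℚᵘ (mkℚᵘ (+ m) 0)) (toℚᵘ-fromℚᵘ (mkℚᵘ (+ n) 0)) ⟨
    toℚᵘ (ι m) ℚᵘ.* toℚᵘ (ι n)      ≈⟨ toℚᵘ-homo-* (ι m) (ι n) ⟨
    toℚᵘ (ι m * ι n)                ∎)
    where open ℚᵘ.≃-Reasoning

  ι-mono-≤ : ∀ {m n} → m ℕ.≤ n → ι m ≤ ι n
  ι-mono-≤ {m} {n} m≤n = toℚᵘ-cancel-≤ (begin
    toℚᵘ (ι m)    ≃⟨ toℚᵘ-fromℚᵘ (mkℚᵘ (+ m) 0) ⟩
    mkℚᵘ (+ m) 0  ≤⟨ *≤* (ℤ.*-monoʳ-≤-nonNeg (+ 1) (ℤ.+≤+ m≤n)) ⟩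
    mkℚᵘ (+ n) 0  ≃⟨ toℚᵘ-fromℚᵘ (mkℚᵘ (+ n) 0) ⟨
    toℚᵘ (ι n)    ∎)
    where open ℚᵘ.≤-Reasoning

  0≤ι : ∀ n → 0ℚ ≤ ι n
  0≤ι n = ι-mono-≤ {0} {n} ℕ.z≤n

  ι-inverse : ∀ n .{{_ : ℕ.NonZero n}} → ι n * (+ 1 / n) ≡ 1ℚ
  ι-inverse (suc n) = toℚᵘ-injective (begin
    toℚᵘ (ι (suc n) * (+ 1 / suc n))
      ≈⟨ toℚᵘ-homo-* (ι (suc n)) (+ 1 / suc n) ⟩
    toℚᵘ (ι (suc n)) ℚᵘ.* toℚᵘ (+ 1 / suc n)
      ≈⟨ ℚᵘ.*-cong (toℚᵘ-fromℚᵘ (mkℚᵘ (+ suc n) 0)) (toℚᵘ-fromℚᵘ (mkℚᵘ (+ 1) n)) ⟩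
    mkℚᵘ (+ suc n) 0 ℚᵘ.* mkℚᵘ (+ 1) n
      ≈⟨ *≡* (trans (ℤ.*-identityʳ (+ suc n ℤ.* + 1)) (trans (ℤ.*-identityʳ (+ suc n))
           (sym (trans (ℤ.*-identityˡ (+ (1 ℕ.* suc n))) (cong +_ (ℕ.*-identityˡ (suc n))))))) ⟩
    toℚᵘ 1ℚ ∎)
    where open ℚᵘ.≃-Reasoning

  p≤q⇒0≤q-p : ∀ {p q} → p ≤ q → 0ℚ ≤ q - p
  p≤q⇒0≤q-p {p} {q} p≤q = subst (_≤ q - p) (+-inverseʳ p) (+-monoˡ-≤ (- p) p≤q)

  -- The tool for polynomial inequalities: the gap is assembled from nonnegative pieces by `_⊕_` and
  -- `_⊗_`, and the ring solver confirms that it is the difference of the two sides.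
  ≤-by-gap : ∀ {p q} d → 0ℚ ≤ d → q ≡ p + d → p ≤ q
  ≤-by-gap {p} d 0≤d refl = subst (_≤ p + d) (+-identityʳ p) (+-monoʳ-≤ p 0≤d)

  infixl 6 _⊕_
  infixl 7 _⊗_

  _⊕_ : ∀ {p q} → 0ℚ ≤ p → 0ℚ ≤ q → 0ℚ ≤ p + q
  _⊕_ = +-mono-≤

  _⊗_ : ∀ {p q} → 0ℚ ≤ p → 0ℚ ≤ q → 0ℚ ≤ p * q
  _⊗_ {p} {q} 0≤p 0≤q = subst (_≤ p * q) (*-zeroʳ p)
    (*-monoˡ-≤-nonNeg p {{nonNegative 0≤p}} 0≤q)

  *-monoˡ-≤-0≤ : ∀ {p q} r → 0ℚ ≤ r → p ≤ q → r * p ≤ r * q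
  *-monoˡ-≤-0≤ r 0≤r = *-monoˡ-≤-nonNeg r {{nonNegative 0≤r}}

  *-monoʳ-≤-0≤ : ∀ {p q} r → 0ℚ ≤ r → p ≤ q → p * r ≤ q * r
  *-monoʳ-≤-0≤ r 0≤r = *-monoʳ-≤-nonNeg r {{nonNegative 0≤r}}

  *-mono-≤-0≤ : ∀ {p q r s} → 0ℚ ≤ p → 0ℚ ≤ r → p ≤ q → r ≤ s → p * r ≤ q * s
  *-mono-≤-0≤ 0≤p 0≤r p≤q r≤s =
    ≤-trans (*-monoˡ-≤-0≤ _ 0≤p r≤s) (*-monoʳ-≤-0≤ _ (≤-trans 0≤r r≤s) p≤q)

  0≤1 : 0ℚ ≤ 1ℚ
  0≤1 = nonNegative⁻¹ 1ℚ

  0≤^ : ∀ {p} n → 0ℚ ≤ p → 0ℚ ≤ p ^ n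
  0≤^ zero    0≤p = 0≤1
  0≤^ (suc n) 0≤p = 0≤p ⊗ 0≤^ n 0≤p

  ^-mono-≤ : ∀ {p q} n → 0ℚ ≤ p → p ≤ q → p ^ n ≤ q ^ n
  ^-mono-≤ zero    0≤p p≤q = ≤-refl
  ^-mono-≤ (suc n) 0≤p p≤q = *-mono-≤-0≤ 0≤p (0≤^ n 0≤p) p≤q (^-mono-≤ n 0≤p p≤q)

  ^≤1 : ∀ {p} n → 0ℚ ≤ p → p ≤ 1ℚ → p ^ n ≤ 1ℚ
  ^≤1 zero    0≤p p≤1 = ≤-refl
  ^≤1 (suc n) 0≤p p≤1 = *-mono-≤-0≤ 0≤p (0≤^ n 0≤p) p≤1 (^≤1 n 0≤p p≤1)

  bernoulli : ∀ {z} n → 0ℚ ≤ z → z ≤ 1ℚ → 1ℚ - ι n * z ≤ (1ℚ - z) ^ n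
  bernoulli {z} zero    0≤z z≤1 = ≤-reflexive
    (solve 1 (λ z → con 1ℚ :- con 0ℚ :* z := con 1ℚ) refl z)
  bernoulli {z} (suc n) 0≤z z≤1 = ≤-trans
    (≤-by-gap (z * z * ι n) (0≤z ⊗ 0≤z ⊗ 0≤ι n)
      (trans (solve 2 (λ z k → (con 1ℚ :- z) :* (con 1ℚ :- k :* z)
                := con 1ℚ :- (con 1ℚ :+ k) :* z :+ z :* z :* k) refl z (ι n))
        (cong (λ k → 1ℚ - k * z + z * z * ι n) (sym (ι-+ 1 n)))))
    (*-monoˡ-≤-0≤ (1ℚ - z) (p≤q⇒0≤q-p z≤1) (bernoulli n 0≤z z≤1))

  archimedean : ∀ p → ∃[ n ] p ≤ ι n
  archimedean p@(mkℚ (+ n) d-1 c) = n , toℚᵘ-cancel-≤ (begin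
    toℚᵘ p        ≤⟨ *≤* (ℤ.*-monoˡ-≤-nonNeg (+ n) (ℤ.+≤+ (ℕ.s≤s ℕ.z≤n))) ⟩
    mkℚᵘ (+ n) 0  ≃⟨ toℚᵘ-fromℚᵘ (mkℚᵘ (+ n) 0) ⟨
    toℚᵘ (ι n)    ∎)
    where open ℚᵘ.≤-Reasoning
  archimedean p@(mkℚ ℤ.-[1+ n ] d-1 c) = 0 , nonPositive⁻¹ p

  -- The search descends from an Archimedean bound and stops as soon as one step less would no
  -- longer reach `u`, so the overshoot is at most one step.
  roundUp : ∀ u z → 0ℚ ≤ u → 0ℚ < z → ∃[ k ] u ≤ ι k * z × ι k * z ≤ u + z
  roundUp u z 0≤u 0<z = search (proj₁ bound) (proj₂ bound)
    where
    instance
      z-pos : Positive z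
      z-pos = positive 0<z
      z-nonZero : NonZero z
      z-nonZero = pos⇒nonZero z
    bound : ∃[ k ] u ≤ ι k * z
    bound =
      let k , u/z≤k = archimedean (u ÷ z)
      in k , ≤-trans (≤-reflexive (sym (trans (*-assoc u (1/ z) z)
                 (trans (cong (u *_) (*-inverseˡ z)) (*-identityʳ u)))))
               (*-monoʳ-≤-0≤ z (<⇒≤ 0<z) u/z≤k)
    search : ∀ k → u ≤ ι k * z → ∃[ k ] u ≤ ι k * z × ι k * z ≤ u + z
    search zero    u≤ = zero , u≤ ,
      ≤-trans (≤-reflexive (*-zeroˡ z)) (0≤u ⊕ <⇒≤ 0<z)
    search (suc k) u≤ with ≤-total u (ι k * z)
    ... | inj₁ u≤kz = search k u≤kz
    ... | inj₂ kz≤u = suc k , u≤ , ≤-trans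
      (≤-reflexive (trans (cong (_* z) (ι-+ 1 k))
        (solve 2 (λ k z → (con 1ℚ :+ k) :* z := k :* z :+ z) refl (ι k) z)))
      (+-monoˡ-≤ z kz≤u)

-- Partial sums of the exponential series against powers of 1 - z.

module Exponential where
  open import Data.Rational.Base
  open import Data.Rational.Properties
  open import Data.Rational.Solver using (module +-*-Solver)
  open +-*-Solver hiding (_:^_)
  open Defs using (1/_!)
  open Arithmetic

  exp : ℕ → ℚ → ℚ
  exp zero    x = 0ℚ
  exp (suc n) x = exp n x + x ^ n * 1/ n !

  0≤1/! : ∀ n → 0ℚ ≤ 1/ n !
  0≤1/! n = nonNegative⁻¹ (1/ n !) {{normalize-nonNeg 1 (n ℕ.!) {{n ℕ.!≢0}}}}

  -- Differentiating the term of degree `suc n` gives the term of degree `n`; hence `exp n`, which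
  -- has n terms, is the formal derivative of `exp (suc n)`.
  1/!-suc : ∀ n → ι (suc n) * 1/ suc n ! ≡ 1/ n !
  1/!-suc n = begin
    ι (suc n) * c′                      ≡⟨ *-identityˡ (ι (suc n) * c′) ⟨
    1ℚ * (ι (suc n) * c′)               ≡⟨ cong (_* (ι (suc n) * c′)) (ι-inverse (n ℕ.!) {{n ℕ.!≢0}}) ⟨
    ι (n ℕ.!) * c * (ι (suc n) * c′)    ≡⟨ solve 4 (λ a b c d → a :* b :* (c :* d) := b :* ((c :* a) :* d)) refl (ι (n ℕ.!)) c (ι (suc n)) c′ ⟩
    c * ((ι (suc n) * ι (n ℕ.!)) * c′)  ≡⟨ cong (λ m → c * (m * c′)) (ι-* (suc n) (n ℕ.!)) ⟨
    c * (ι (suc n ℕ.!) * c′)            ≡⟨ cong (c *_) (ι-inverse (suc n ℕ.!) {{suc n ℕ.!≢0}}) ⟩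
    c * 1ℚ                              ≡⟨ *-identityʳ c ⟩
    c                                   ∎
    where
    open ≡-Reasoning
    c c′ : ℚ
    c  = 1/ n !
    c′ = 1/ suc n !

  exp-mono-≤ : ∀ n {x y} → 0ℚ ≤ x → x ≤ y → exp n x ≤ exp n y
  exp-mono-≤ zero    0≤x x≤y = ≤-refl
  exp-mono-≤ (suc n) 0≤x x≤y = +-mono-≤ (exp-mono-≤ n 0≤x x≤y)
    (*-monoʳ-≤-0≤ (1/ n !) (0≤1/! n) (^-mono-≤ n 0≤x x≤y))

  exp-0 : ∀ n → exp (suc n) 0ℚ ≡ 1ℚ
  exp-0 zero    = refl
  exp-0 (suc n) = trans (cong₂ _+_ (exp-0 n)
    (trans (cong (_* 1/ suc n !) (*-zeroˡ (0ℚ ^ n))) (*-zeroˡ (1/ suc n !)))) (+-identityʳ 1ℚ)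

  exp-0≤1 : ∀ n → exp n 0ℚ ≤ 1ℚ
  exp-0≤1 zero    = 0≤1
  exp-0≤1 (suc n) = ≤-reflexive (exp-0 n)

  -- A mean value estimate with the derivative taken at the right endpoint, where it is largest.
  ^-shift : ∀ n {a z} → 0ℚ ≤ a → 0ℚ ≤ z →
    (a + z) ^ suc n ≤ a ^ suc n + ι (suc n) * (z * (a + z) ^ n)
  ^-shift zero {a} {z} 0≤a 0≤z = ≤-reflexive
    (solve 2 (λ a z → (a :+ z) :* con 1ℚ := a :* con 1ℚ :+ con 1ℚ :* (z :* con 1ℚ)) refl a z)
  ^-shift (suc n) {a} {z} 0≤a 0≤z = begin
    b * b ^ suc n
      ≤⟨ *-monoˡ-≤-0≤ b 0≤b (^-shift n 0≤a 0≤z) ⟩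
    b * (a ^ suc n + ι (suc n) * (z * b ^ n))
      ≡⟨ solve 5 (λ a z p q k → (a :+ z) :* (p :+ k :* (z :* q)) := a :* p :+ k :* (z :* ((a :+ z) :* q)) :+ z :* p)
           refl a z (a ^ suc n) (b ^ n) (ι (suc n)) ⟩
    a * a ^ suc n + ι (suc n) * (z * b ^ suc n) + z * a ^ suc n
      ≤⟨ +-monoʳ-≤ (a * a ^ suc n + ι (suc n) * (z * b ^ suc n)) (*-monoˡ-≤-0≤ z 0≤z (^-mono-≤ (suc n) 0≤a a≤b)) ⟩
    a * a ^ suc n + ι (suc n) * (z * b ^ suc n) + z * b ^ suc n
      ≡⟨ solve 3 (λ p k r → p :+ k :* r :+ r := p :+ (con 1ℚ :+ k) :* r) refl (a * a ^ suc n) (ι (suc n)) (z * b ^ suc n) ⟩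
    a * a ^ suc n + (1ℚ + ι (suc n)) * (z * b ^ suc n)
      ≡⟨ cong (λ k → a * a ^ suc n + k * (z * b ^ suc n)) (ι-+ 1 (suc n)) ⟨
    a * a ^ suc n + ι (suc (suc n)) * (z * b ^ suc n) ∎
    where
    open ≤-Reasoning
    b : ℚ
    b = a + z
    0≤b : 0ℚ ≤ b
    0≤b = 0≤a ⊕ 0≤z
    a≤b : a ≤ b
    a≤b = ≤-by-gap z 0≤z refl

  -- `^-shift` applied to each term; by `1/!-suc` the derivatives of the terms add up to the shorter
  -- sum.
  exp-shift : ∀ n {a z} → 0ℚ ≤ a → 0ℚ ≤ z → exp (suc n) (a + z) ≤ exp (suc n) a + z * exp n (a + z)
  exp-shift zero {a} {z} 0≤a 0≤z = ≤-reflexive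
    (sym (trans (cong (λ r → exp 1 a + r) (*-zeroʳ z)) (+-identityʳ (exp 1 a))))
  exp-shift (suc n) {a} {z} 0≤a 0≤z = begin
    exp (suc n) b + b ^ suc n * c′
      ≤⟨ +-mono-≤ (exp-shift n 0≤a 0≤z) (*-monoʳ-≤-0≤ c′ (0≤1/! (suc n)) (^-shift n 0≤a 0≤z)) ⟩
    exp (suc n) a + z * exp n b + (a ^ suc n + ι (suc n) * (z * b ^ n)) * c′
      ≡⟨ solve 7 (λ E z F p k q c → E :+ z :* F :+ (p :+ k :* (z :* q)) :* c := E :+ p :* c :+ z :* (F :+ q :* (k :* c)))
           refl (exp (suc n) a) z (exp n b) (a ^ suc n) (ι (suc n)) (b ^ n) c′ ⟩
    exp (suc n) a + a ^ suc n * c′ + z * (exp n b + b ^ n * (ι (suc n) * c′))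
      ≡⟨ cong (λ c → exp (suc n) a + a ^ suc n * c′ + z * (exp n b + b ^ n * c)) (1/!-suc n) ⟩
    exp (suc (suc n)) a + z * exp (suc n) b ∎
    where
    open ≤-Reasoning
    b c′ : ℚ
    b  = a + z
    c′ = 1/ suc n !

  -- The finite substitute for (1 - z)^k ≤ e^(-kz). Writing E for the partial sum, `exp-shift` gives
  -- E(a + z) ≤ E(a) + z E(a + z), so each factor 1 - z pays for one step from a + z down to a,
  -- ending at E(0) ≤ 1.
  exp*[1-z]^≤1 : ∀ n k {z} → 0ℚ ≤ z → z ≤ 1ℚ → exp n (ι k * z) * (1ℚ - z) ^ k ≤ 1ℚ
  exp*[1-z]^≤1 n zero {z} 0≤z z≤1 = ≤-trans (≤-reflexive (*-identityʳ (exp n (0ℚ * z))))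
    (≤-trans (≤-reflexive (cong (exp n) (*-zeroˡ z))) (exp-0≤1 n))
  exp*[1-z]^≤1 n (suc k) {z} 0≤z z≤1 = begin
    exp n (ι (suc k) * z) * ((1ℚ - z) * (1ℚ - z) ^ k)
      ≡⟨ cong (λ x → exp n x * ((1ℚ - z) * (1ℚ - z) ^ k))
           (trans (cong (_* z) (ι-+ 1 k)) (solve 2 (λ k z → (con 1ℚ :+ k) :* z := k :* z :+ z) refl (ι k) z)) ⟩
    exp n (a + z) * ((1ℚ - z) * (1ℚ - z) ^ k)
      ≡⟨ *-assoc (exp n (a + z)) (1ℚ - z) ((1ℚ - z) ^ k) ⟨
    exp n (a + z) * (1ℚ - z) * (1ℚ - z) ^ k
      ≤⟨ *-monoʳ-≤-0≤ _ (0≤^ k (p≤q⇒0≤q-p z≤1)) (step n) ⟩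
    exp n a * (1ℚ - z) ^ k
      ≤⟨ exp*[1-z]^≤1 n k 0≤z z≤1 ⟩
    1ℚ ∎
    where
    open ≤-Reasoning
    a : ℚ
    a = ι k * z
    0≤a : 0ℚ ≤ a
    0≤a = 0≤ι k ⊗ 0≤z
    step : ∀ n → exp n (a + z) * (1ℚ - z) ≤ exp n a
    step zero    = ≤-reflexive (*-zeroˡ (1ℚ - z))
    step (suc n) = ≤-by-gap _
      (p≤q⇒0≤q-p (exp-shift n 0≤a 0≤z) ⊕ 0≤z ⊗ (0≤^ n (0≤a ⊕ 0≤z) ⊗ 0≤1/! n))
      (solve 4 (λ A F t z → A := (F :+ t) :* (con 1ℚ :- z) :+ (A :+ z :* F :- (F :+ t) :+ z :* t))
        refl (exp (suc n) a) (exp n (a + z)) ((a + z) ^ n * 1/ n !) z)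

  -- Second-order expansion and a bound on the negative axis.

  remainder : ℕ → ℚ → ℚ → ℚ
  remainder zero    a h = 0ℚ
  remainder (suc n) a h = (a + h) * remainder n a h + ι (suc n) * a ^ n

  -- `remainder` is the cofactor of h² in this expansion; its recursion comes from multiplying the
  -- expansion by a + h and collecting what is divisible by h².
  ^-taylor : ∀ n a h →
    (a + h) ^ suc n ≡ a ^ suc n + ι (suc n) * (h * a ^ n) + h * h * remainder n a h
  ^-taylor zero a h =
    solve 2 (λ a h → (a :+ h) :* con 1ℚ := a :* con 1ℚ :+ con 1ℚ :* (h :* con 1ℚ) :+ h :* h :* con 0ℚ) refl a h
  ^-taylor (suc n) a h = trans (cong ((a + h) *_) (^-taylor n a h))
    (trans (solve 5 (λ a h p k r →
        (a :+ h) :* (a :* p :+ k :* (h :* p) :+ h :* h :* r)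
        := a :* (a :* p) :+ (con 1ℚ :+ k) :* (h :* (a :* p)) :+ h :* h :* ((a :+ h) :* r :+ k :* p))
        refl a h (a ^ n) (ι (suc n)) (remainder n a h))
      (cong (λ k → a ^ suc (suc n) + k * (h * a ^ suc n) + h * h * remainder (suc n) a h)
        (sym (ι-+ 1 (suc n)))))

  ∣^∣≤ : ∀ n {a X} → ∣ a ∣ ≤ X → ∣ a ^ n ∣ ≤ X ^ n
  ∣^∣≤ zero    a≤X = ≤-refl
  ∣^∣≤ (suc n) {a} a≤X = ≤-trans (≤-reflexive (∣p*q∣≡∣p∣*∣q∣ a (a ^ n)))
    (*-mono-≤-0≤ (0≤∣p∣ a) (0≤∣p∣ (a ^ n)) a≤X (∣^∣≤ n a≤X))

  remainderBound : ℕ → ℚ → ℚ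
  remainderBound zero    X = 0ℚ
  remainderBound (suc n) X = X * remainderBound n X + ι (suc n) * X ^ n

  ∣remainder∣≤ : ∀ n {a h X} → ∣ a ∣ ≤ X → ∣ a + h ∣ ≤ X → ∣ remainder n a h ∣ ≤ remainderBound n X
  ∣remainder∣≤ zero    a≤X a+h≤X = ≤-refl
  ∣remainder∣≤ (suc n) {a} {h} {X} a≤X a+h≤X = begin
    ∣ (a + h) * r + ι (suc n) * a ^ n ∣            ≤⟨ ∣p+q∣≤∣p∣+∣q∣ ((a + h) * r) (ι (suc n) * a ^ n) ⟩
    ∣ (a + h) * r ∣ + ∣ ι (suc n) * a ^ n ∣        ≡⟨ cong₂ _+_ (∣p*q∣≡∣p∣*∣q∣ (a + h) r) (∣p*q∣≡∣p∣*∣q∣ (ι (suc n)) (a ^ n)) ⟩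
    ∣ a + h ∣ * ∣ r ∣ + ∣ ι (suc n) ∣ * ∣ a ^ n ∣  ≤⟨ +-mono-≤
      (*-mono-≤-0≤ (0≤∣p∣ (a + h)) (0≤∣p∣ r) a+h≤X (∣remainder∣≤ n a≤X a+h≤X))
      (*-mono-≤-0≤ (0≤∣p∣ (ι (suc n))) (0≤∣p∣ (a ^ n)) (≤-reflexive (0≤p⇒∣p∣≡p (0≤ι (suc n)))) (∣^∣≤ n a≤X)) ⟩
    X * remainderBound n X + ι (suc n) * X ^ n     ∎
    where
    open ≤-Reasoning
    r : ℚ
    r = remainder n a h

  p≤∣p∣ : ∀ p → p ≤ ∣ p ∣
  p≤∣p∣ p with ≤-total 0ℚ p
  ... | inj₁ 0≤p = ≤-reflexive (sym (0≤p⇒∣p∣≡p 0≤p))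
  ... | inj₂ p≤0 = ≤-trans p≤0 (0≤∣p∣ p)

  0≤sq : ∀ p → 0ℚ ≤ p * p
  0≤sq p with ≤-total 0ℚ p
  ... | inj₁ 0≤p = 0≤p ⊗ 0≤p
  ... | inj₂ p≤0 = subst (0ℚ ≤_)
    (solve 1 (λ p → (:- p) :* (:- p) := p :* p) refl p)
    (neg-antimono-≤ p≤0 ⊗ neg-antimono-≤ p≤0)

  -- Here `a` and `h` may have either sign, which `exp-shift` excludes; the price is a quadratic
  -- error, with a constant uniform on [-X, X] that sums the bounds on the remainders.
  exp-taylor : ∀ n X → 0ℚ ≤ X → ∃[ D ] 0ℚ ≤ D × (∀ a h → ∣ a ∣ ≤ X → ∣ a + h ∣ ≤ X →
    exp (suc n) (a + h) ≤ exp (suc n) a + h * exp n a + D * (h * h))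
  exp-taylor zero X 0≤X = 0ℚ , ≤-refl , λ a h _ _ → ≤-reflexive
    (solve 2 (λ a h → con 1ℚ := con 1ℚ :+ h :* con 0ℚ :+ con 0ℚ :* (h :* h)) refl a h)
  exp-taylor (suc n) X 0≤X =
    let D , 0≤D , bound = exp-taylor n X 0≤X
    in D + B * c′ , 0≤D ⊕ 0≤B n ⊗ 0≤1/! (suc n) , λ a h a≤X a+h≤X → begin
      exp (suc n) (a + h) + (a + h) ^ suc n * c′
        ≤⟨ +-mono-≤ (bound a h a≤X a+h≤X) (*-monoʳ-≤-0≤ c′ (0≤1/! (suc n))
             (≤-trans (≤-reflexive (^-taylor n a h))
               (+-monoʳ-≤ (a ^ suc n + ι (suc n) * (h * a ^ n)) (*-monoˡ-≤-0≤ (h * h) (0≤sq h)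
                 (≤-trans (p≤∣p∣ (remainder n a h)) (∣remainder∣≤ n a≤X a+h≤X)))))) ⟩
      exp (suc n) a + h * exp n a + D * (h * h)
        + (a ^ suc n + ι (suc n) * (h * a ^ n) + h * h * B) * c′
        ≡⟨ solve 9 (λ E h F D p k q B c →
             E :+ h :* F :+ D :* (h :* h) :+ (p :+ k :* (h :* q) :+ h :* h :* B) :* c
             := E :+ p :* c :+ h :* (F :+ q :* (k :* c)) :+ (D :+ B :* c) :* (h :* h))
             refl (exp (suc n) a) h (exp n a) D (a ^ suc n) (ι (suc n)) (a ^ n) B c′ ⟩
      exp (suc n) a + a ^ suc n * c′ + h * (exp n a + a ^ n * (ι (suc n) * c′)) + (D + B * c′) * (h * h)
        ≡⟨ cong (λ c → exp (suc n) a + a ^ suc n * c′ + h * (exp n a + a ^ n * c) + (D + B * c′) * (h * h)) (1/!-suc n) ⟩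
      exp (suc (suc n)) a + h * exp (suc n) a + (D + B * c′) * (h * h) ∎
    where
    open ≤-Reasoning
    B c′ : ℚ
    B  = remainderBound n X
    c′ = 1/ suc n !
    0≤B : ∀ n → 0ℚ ≤ remainderBound n X
    0≤B zero    = ≤-refl
    0≤B (suc n) = 0≤X ⊗ 0≤B n ⊕ 0≤ι (suc n) ⊗ 0≤^ n 0≤X

  -- The power is `a` times a square. The exponent is the degree of the last term in a sum of 2m + 2
  -- terms.
  odd^≤0 : ∀ m {a} → a ≤ 0ℚ → a ^ suc (m ℕ.+ m) ≤ 0ℚ
  odd^≤0 m {a} a≤0 = subst (_≤ 0ℚ) (cong (a *_) (sym (^-homo-* a m m)))
    (subst (a * (a ^ m * a ^ m) ≤_) (*-zeroˡ (a ^ m * a ^ m)) (*-monoʳ-≤-0≤ _ (0≤sq (a ^ m)) a≤0))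

  -- A number of parts above x + E x makes both x and E x at most 1 after division; taking a
  -- successor keeps that number nonzero.
  subdivide : ∀ x E → 0ℚ ≤ x → 0ℚ ≤ E →
    ∃[ k ] ∃[ z ] ι k * z ≡ x × 0ℚ ≤ z × z ≤ 1ℚ × E * z ≤ 1ℚ
  subdivide x E 0≤x 0≤E with archimedean (x + E * x)
  ... | k , bound = suc k , x * r , kz≡x , 0≤x ⊗ 0≤r
    , ≤-trans (*-monoʳ-≤-0≤ r 0≤r x≤k) (≤-reflexive (ι-inverse (suc k)))
    , ≤-trans (≤-reflexive (sym (*-assoc E x r)))
        (≤-trans (*-monoʳ-≤-0≤ r 0≤r Ex≤k) (≤-reflexive (ι-inverse (suc k))))
    where
    r : ℚ
    r = + 1 / suc k
    0≤r : 0ℚ ≤ r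
    0≤r = nonNegative⁻¹ r {{normalize-nonNeg 1 (suc k)}}
    bound′ : x + E * x ≤ ι (suc k)
    bound′ = ≤-trans bound (ι-mono-≤ (ℕ.n≤1+n k))
    x≤k : x ≤ ι (suc k)
    x≤k = ≤-trans (≤-by-gap {x} (E * x) (0≤E ⊗ 0≤x) refl) bound′
    Ex≤k : E * x ≤ ι (suc k)
    Ex≤k = ≤-trans (≤-by-gap {E * x} x 0≤x (+-comm x (E * x))) bound′
    kz≡x : ι (suc k) * (x * r) ≡ x
    kz≡x = trans (solve 3 (λ k x r → k :* (x :* r) := x :* (k :* r)) refl (ι (suc k)) x r)
      (trans (cong (x *_) (ι-inverse (suc k))) (*-identityʳ x))

  ι-suc-* : ∀ i z → ι (suc i) * z ≡ ι i * z + z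
  ι-suc-* i z = trans (cong (_* z) (ι-+ 1 i))
    (solve 2 (λ i z → (con 1ℚ :+ i) :* z := i :* z :+ z) refl (ι i) z)

  -- A discrete Gronwall argument: the factor 1 - z does not amplify earlier errors, so i steps add
  -- at most i e to the initial bound 1.
  recurrence≤ : ∀ (F : ℚ → ℚ) x z e → 0ℚ ≤ z → z ≤ 1ℚ → 0ℚ ≤ e → F (- 0ℚ) ≤ 1ℚ →
    (∀ a → 0ℚ ≤ a → a + z ≤ x → F (- (a + z)) ≤ (1ℚ - z) * F (- a) + e) →
    ∀ i → ι i * z ≤ x → F (- (ι i * z)) ≤ 1ℚ + ι i * e
  recurrence≤ F x z e 0≤z z≤1 0≤e F0 step zero iz≤x = begin
    F (- (0ℚ * z))  ≡⟨ cong (λ y → F (- y)) (*-zeroˡ z) ⟩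
    F (- 0ℚ)        ≤⟨ F0 ⟩
    1ℚ              ≡⟨ solve 1 (λ e → con 1ℚ := con 1ℚ :+ con 0ℚ :* e) refl e ⟩
    1ℚ + 0ℚ * e     ∎
    where open ≤-Reasoning
  recurrence≤ F x z e 0≤z z≤1 0≤e F0 step (suc i) i+1z≤x = begin
    F (- (ι (suc i) * z))
      ≡⟨ cong (λ y → F (- y)) (ι-suc-* i z) ⟩
    F (- (ι i * z + z))
      ≤⟨ step (ι i * z) (0≤ι i ⊗ 0≤z) iz+z≤x ⟩
    (1ℚ - z) * F (- (ι i * z)) + e
      ≤⟨ +-monoˡ-≤ e (*-monoˡ-≤-0≤ (1ℚ - z) (p≤q⇒0≤q-p z≤1)
           (recurrence≤ F x z e 0≤z z≤1 0≤e F0 step i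
             (≤-trans (≤-by-gap z 0≤z refl) iz+z≤x))) ⟩
    (1ℚ - z) * (1ℚ + ι i * e) + e
      ≤⟨ ≤-by-gap (z + z * (ι i * e)) (0≤z ⊕ 0≤z ⊗ (0≤ι i ⊗ 0≤e))
           (solve 3 (λ z i e → con 1ℚ :+ (i :* e :+ e)
             := (con 1ℚ :- z) :* (con 1ℚ :+ i :* e) :+ e :+ (z :+ z :* (i :* e))) refl z (ι i) e) ⟩
    1ℚ + (ι i * e + e)
      ≡⟨ cong (λ y → 1ℚ + y) (ι-suc-* i e) ⟨
    1ℚ + ι (suc i) * e ∎
    where
    open ≤-Reasoning
    iz+z≤x : ι i * z + z ≤ x
    iz+z≤x = subst (_≤ x) (ι-suc-* i z) i+1z≤x

  ∣-u∣≤ : ∀ {u x} → 0ℚ ≤ u → u ≤ x → ∣ - u ∣ ≤ x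
  ∣-u∣≤ {u} 0≤u u≤x = ≤-trans (≤-reflexive (trans (∣-p∣≡∣p∣ u) (0≤p⇒∣p∣≡p 0≤u))) u≤x

  -- With an even number of terms the last one is nonpositive on the negative axis, so there the
  -- partial sum E satisfies E(−a − z) ≤ (1 − z) E(−a) + D z².
  exp-neg-step : ∀ m x → 0ℚ ≤ x → ∃[ D ] 0ℚ ≤ D × (∀ a z → 0ℚ ≤ a → 0ℚ ≤ z → a + z ≤ x →
    exp (suc (suc (m ℕ.+ m))) (- (a + z))
      ≤ (1ℚ - z) * exp (suc (suc (m ℕ.+ m))) (- a) + D * (z * z))
  exp-neg-step m x 0≤x =
    let D , 0≤D , taylor = exp-taylor n x 0≤x
    in D , 0≤D , λ a z 0≤a 0≤z a+z≤x →
      subst (λ y → exp (suc n) y ≤ (1ℚ - z) * exp (suc n) (- a) + D * (z * z))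
        (sym (neg-distrib-+ a z))
        (damp (exp (suc n) (- a + - z)) (exp n (- a)) ((- a) ^ n) (1/ n !) z D 0≤z
          (odd^≤0 m (neg-antimono-≤ 0≤a)) (0≤1/! n)
          (taylor (- a) (- z)
            (∣-u∣≤ 0≤a (≤-trans (≤-by-gap z 0≤z refl) a+z≤x))
            (subst (λ y → ∣ y ∣ ≤ x) (neg-distrib-+ a z) (∣-u∣≤ (0≤a ⊕ 0≤z) a+z≤x))))
    where
    n : ℕ
    n = suc (m ℕ.+ m)
    -- `F` is the sum without its last term `p * c` ≤ 0, so -z F ≤ -z (F + p c), and the full sum
    -- can take the place of its derivative.
    damp : ∀ E F p c z D → 0ℚ ≤ z → p ≤ 0ℚ → 0ℚ ≤ c →
      E ≤ F + p * c + - z * F + D * (- z * - z) → E ≤ (1ℚ - z) * (F + p * c) + D * (z * z)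
    damp E F p c z D 0≤z p≤0 0≤c E≤ = ≤-by-gap _
      (p≤q⇒0≤q-p E≤ ⊕ 0≤z ⊗ (neg-antimono-≤ p≤0 ⊗ 0≤c))
      (solve 6 (λ E F p c z D →
        (con 1ℚ :- z) :* (F :+ p :* c) :+ D :* (z :* z)
        := E :+ ((F :+ p :* c) :+ (:- z) :* F :+ D :* ((:- z) :* (:- z)) :- E :+ z :* ((:- p) :* c)))
        refl E F p c z D)

  -- Walking from 0 down to −x in k steps of length z = x / k accumulates an error of D x z.
  exp-neg≤2 : ∀ m x → 0ℚ ≤ x → exp (suc (suc (m ℕ.+ m))) (- x) ≤ 1ℚ + 1ℚ
  exp-neg≤2 m x 0≤x =
    let D , 0≤D , step = exp-neg-step m x 0≤x
        k , z , kz≡x , 0≤z , z≤1 , Dxz≤1 = subdivide x (D * x) 0≤x (0≤D ⊗ 0≤x)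
    in walk D 0≤D k z kz≡x 0≤z Dxz≤1
      (recurrence≤ (exp n) x z (D * (z * z)) 0≤z z≤1 (0≤D ⊗ (0≤z ⊗ 0≤z))
        (≤-reflexive (exp-0 (suc (m ℕ.+ m)))) (λ a 0≤a → step a z 0≤a 0≤z) k (≤-reflexive kz≡x))
    where
    n : ℕ
    n = suc (suc (m ℕ.+ m))
    walk : ∀ D → 0ℚ ≤ D → ∀ k z → ι k * z ≡ x → 0ℚ ≤ z → D * x * z ≤ 1ℚ →
      exp n (- (ι k * z)) ≤ 1ℚ + ι k * (D * (z * z)) → exp n (- x) ≤ 1ℚ + 1ℚ
    walk D 0≤D k z refl 0≤z Dxz≤1 h = ≤-trans h (+-monoʳ-≤ 1ℚ (≤-trans (≤-reflexive
      (solve 3 (λ k D z → k :* (D :* (z :* z)) := D :* (k :* z) :* z) refl (ι k) D z)) Dxz≤1))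

-- Multisets of vertices and the repair of uncovered edges.

module Transversals where
  open Defs using (Hypergraph; edges; edges≢[]; edgesNonempty; degree; maxDegree;
    sumℕ; sumℕ-over; IsFoldTransversalNumber)
  open import Algebra.Properties.CommutativeMonoid.Sum ℕ.+-0-commutativeMonoid
    using () renaming (sum-cong-≗ to sumℕ-cong; ∑-distrib-+ to sumℕ-distrib-+; sum-replicate-zero to sumℕ-zero)

  sumℕ-mono : ∀ {n} {A B : Fin n → ℕ} → (∀ x → A x ℕ.≤ B x) → sumℕ A ℕ.≤ sumℕ B
  sumℕ-mono {zero}  A≤B = ℕ.z≤n
  sumℕ-mono {suc n} A≤B = ℕ.+-mono-≤ (A≤B zero) (sumℕ-mono (λ x → A≤B (suc x)))

  sumℕ-over-mono : ∀ {n} (F : Subset n) {A B : Fin n → ℕ} → (∀ x → A x ℕ.≤ B x) →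
    sumℕ-over F A ℕ.≤ sumℕ-over F B
  sumℕ-over-mono F {A} {B} A≤B = sumℕ-mono (λ x → if-mono (does (x ∈? F)) (A≤B x))
    where
    if-mono : ∀ b {k l} → k ℕ.≤ l → (if b then k else 0) ℕ.≤ (if b then l else 0)
    if-mono true  k≤l = k≤l
    if-mono false k≤l = ℕ.z≤n

  sumℕ-over-0 : ∀ {n} (F : Subset n) → sumℕ-over F (λ _ → 0) ≡ 0
  sumℕ-over-0 {n} F = trans (sumℕ-cong (λ x → if-same (does (x ∈? F)))) (sumℕ-zero n)
    where
    if-same : ∀ b → (if b then 0 else 0) ≡ 0
    if-same true  = refl
    if-same false = refl

  sumℕ-delta : ∀ {n} (x : Fin n) (h : Fin n → ℕ) →
    sumℕ (λ y → if does (x Fin.≟ y) then h y else 0) ≡ h x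
  sumℕ-delta {suc n} zero    h = trans (cong (h zero ℕ.+_) (sumℕ-zero n)) (ℕ.+-identityʳ (h zero))
  sumℕ-delta {suc n} (suc x) h = sumℕ-delta x (λ y → h (suc y))

  add : ∀ {n} → ℕ → Fin n → (Fin n → ℕ) → Fin n → ℕ
  add k x A y = (if does (x Fin.≟ y) then k else 0) ℕ.+ A y

  sumℕ-add : ∀ {n} k (x : Fin n) A → sumℕ (add k x A) ≡ k ℕ.+ sumℕ A
  sumℕ-add k x A = trans (sumℕ-distrib-+ (λ y → if does (x Fin.≟ y) then k else 0) A)
    (cong (ℕ._+ sumℕ A) (sumℕ-delta x (λ _ → k)))

  sumℕ-over-add : ∀ {n} (F : Subset n) k x A →
    sumℕ-over F (add k x A) ≡ (if does (x ∈? F) then k else 0) ℕ.+ sumℕ-over F A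
  sumℕ-over-add F k x A = begin
    sumℕ-over F (add k x A)
      ≡⟨ sumℕ-cong (λ y → regroup (does (y ∈? F)) (does (x Fin.≟ y)) (A y)) ⟩
    sumℕ (λ y → (if does (x Fin.≟ y) then (if does (y ∈? F) then k else 0) else 0)
      ℕ.+ (if does (y ∈? F) then A y else 0))
      ≡⟨ sumℕ-distrib-+ (λ y → if does (x Fin.≟ y) then (if does (y ∈? F) then k else 0) else 0) _ ⟩
    sumℕ (λ y → if does (x Fin.≟ y) then (if does (y ∈? F) then k else 0) else 0) ℕ.+ sumℕ-over F A
      ≡⟨ cong (ℕ._+ sumℕ-over F A) (sumℕ-delta x (λ y → if does (y ∈? F) then k else 0)) ⟩
    (if does (x ∈? F) then k else 0) ℕ.+ sumℕ-over F A ∎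
    where
    open ≡-Reasoning
    regroup : ∀ a b l → (if a then (if b then k else 0) ℕ.+ l else 0)
      ≡ (if b then (if a then k else 0) else 0) ℕ.+ (if a then l else 0)
    regroup true  true  l = refl
    regroup true  false l = refl
    regroup false true  l = refl
    regroup false false l = refl

  deficit : ∀ {n} → ℕ → List (Subset n) → (Fin n → ℕ) → ℕ
  deficit f []       A = 0
  deficit f (F ∷ Es) A = (f ℕ.∸ sumℕ-over F A) ℕ.+ deficit f Es A

  -- For each edge, one of its vertices is added as often as elements are missing. Deficits are
  -- measured against the original `A`, which makes the size exact; later additions only help the
  -- other edges.
  repair : ∀ {n} f (Es : List (Subset n)) A → All Nonempty Es →
    ∃[ B ] (∀ x → A x ℕ.≤ B x) × sumℕ B ≡ deficit f Es A ℕ.+ sumℕ A ×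
      All (λ F → f ℕ.≤ sumℕ-over F B) Es
  repair f []       A []                     = A , (λ x → ℕ.≤-refl) , refl , []
  repair f (F ∷ Es) A ((x , x∈F) ∷ nonempty) =
    let B , A≤B , sumB , covers = repair f Es A nonempty
        d = f ℕ.∸ sumℕ-over F A
        B≤B′ = λ y → ℕ.m≤n+m (B y) (if does (x Fin.≟ y) then d else 0)
    in add d x B
     , (λ y → ℕ.≤-trans (A≤B y) (B≤B′ y))
     , trans (sumℕ-add d x B) (trans (cong (d ℕ.+_) sumB) (sym (ℕ.+-assoc d (deficit f Es A) (sumℕ A))))
     , (let open ℕ.≤-Reasoning in begin
          f                                              ≤⟨ ℕ.m≤n+m∸n f (sumℕ-over F A) ⟩
          sumℕ-over F A ℕ.+ d                            ≡⟨ ℕ.+-comm (sumℕ-over F A) d ⟩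
          d ℕ.+ sumℕ-over F A                            ≤⟨ ℕ.+-monoʳ-≤ d (sumℕ-over-mono F A≤B) ⟩
          d ℕ.+ sumℕ-over F B                            ≡⟨ cong (λ b → (if b then d else 0) ℕ.+ sumℕ-over F B) (dec-true (x ∈? F) x∈F) ⟨
          (if does (x ∈? F) then d else 0) ℕ.+ sumℕ-over F B ≡⟨ sumℕ-over-add F d x B ⟨
          sumℕ-over F (add d x B)                        ∎)
       ∷ All.map (λ {G} f≤ → ℕ.≤-trans f≤ (sumℕ-over-mono G B≤B′)) covers

  ≤maximum : ∀ {n} (g : Fin n → ℕ) x → g x ℕ.≤ Vector.foldr ℕ._⊔_ 0 g
  ≤maximum g zero    = ℕ.m≤m⊔n (g zero) _
  ≤maximum g (suc x) = ℕ.≤-trans (≤maximum (λ y → g (suc y)) x) (ℕ.m≤n⊔m (g zero) _)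

  open import Data.Rational.Base
  open import Data.Rational.Properties
  open import Data.Rational.Solver using (module +-*-Solver)
  open +-*-Solver hiding (_:^_)
  open import Algebra.Bundles using (CommutativeRing)
  open CommutativeRing +-*-commutativeRing using (semiring; commutativeSemiring)
  open import Algebra.Properties.Semiring.Sum semiring
    using (sum; sum-cong-≗; ∑-distrib-+; *-distribˡ-sum; *-distribʳ-sum)
  open import Algebra.Properties.CommutativeSemiring.Exp commutativeSemiring using (^-distrib-*)
  open Arithmetic
  open Exponential

  -- Sums of rational weights and the averaging choice.

  sum-mono : ∀ {n} {v w : Fin n → ℚ} → (∀ x → v x ≤ w x) → sum v ≤ sum w
  sum-mono {zero}  v≤w = ≤-refl
  sum-mono {suc n} v≤w = +-mono-≤ (v≤w zero) (sum-mono (λ x → v≤w (suc x)))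

  0≤sum : ∀ {n} {w : Fin n → ℚ} → (∀ x → 0ℚ ≤ w x) → 0ℚ ≤ sum w
  0≤sum {zero}  0≤w = ≤-refl
  0≤sum {suc n} 0≤w = 0≤w zero ⊕ 0≤sum (λ x → 0≤w (suc x))

  sum-over : ∀ {n} → Subset n → (Fin n → ℚ) → ℚ
  sum-over F w = sum (λ x → if does (x ∈? F) then w x else 0ℚ)

  sum-over≤sum : ∀ {n} (F : Subset n) {w} → (∀ x → 0ℚ ≤ w x) → sum-over F w ≤ sum w
  sum-over≤sum F {w} 0≤w = sum-mono (λ x → if≤ (does (x ∈? F)) (0≤w x))
    where
    if≤ : ∀ b {p} → 0ℚ ≤ p → (if b then p else 0ℚ) ≤ p
    if≤ true  0≤p = ≤-refl
    if≤ false 0≤p = 0≤p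

  minimum : ∀ {n} → Fin n → (φ : Fin n → ℚ) → ∃[ x ] (∀ y → φ x ≤ φ y)
  minimum {suc zero}    _ φ = zero , λ { zero → ≤-refl }
  minimum {suc (suc n)} _ φ =
    let x , φx≤ = minimum zero (λ y → φ (suc y))
    in compare x φx≤ (≤-total (φ zero) (φ (suc x)))
    where
    compare : ∀ x → (∀ y → φ (suc x) ≤ φ (suc y)) →
      φ zero ≤ φ (suc x) ⊎ φ (suc x) ≤ φ zero → ∃[ x ] (∀ y → φ x ≤ φ y)
    compare x φx≤ (inj₁ φ0≤) = zero  , λ { zero → ≤-refl ; (suc y) → ≤-trans φ0≤ (φx≤ y) }
    compare x φx≤ (inj₂ ≤φ0) = suc x , λ { zero → ≤φ0 ; (suc y) → φx≤ y }

  -- Derandomisation: a vertex minimising `φ` does at least as well as a vertex drawn with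
  -- probability proportional to `w`. The given vertex shows that there is one to choose.
  averaging : ∀ {n} → Fin n → (w φ : Fin n → ℚ) → (∀ x → 0ℚ ≤ w x) →
    ∃[ x ] φ x * sum w ≤ sum (λ y → w y * φ y)
  averaging x₀ w φ 0≤w =
    let x , φx≤ = minimum x₀ φ
    in x , ≤-trans (≤-reflexive (*-distribˡ-sum (φ x) w))
      (sum-mono (λ y → ≤-trans (≤-reflexive (*-comm (φ x) (w y))) (*-monoˡ-≤-0≤ (w y) (0≤w y) (φx≤ y))))

  -- The potential and its average decrease.

  ⅔ : ℚ
  ⅔ = + 2 / 3

  weight : ℕ → ℚ
  weight zero    = 0ℚ
  weight (suc d) = ι 3 ^ d

  0≤weight : ∀ d → 0ℚ ≤ weight d
  0≤weight zero    = ≤-refl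
  0≤weight (suc d) = 0≤^ d (0≤ι 3)

  ι≤weight : ∀ d → ι d ≤ weight d
  ι≤weight zero          = ≤-refl
  ι≤weight (suc zero)    = ≤-refl
  ι≤weight (suc (suc d)) = begin
    ι (suc (suc d))              ≡⟨ ι-+ 1 (suc d) ⟩
    1ℚ + ι (suc d)               ≤⟨ ≤-by-gap (ι d + ι (suc d)) (0≤ι d ⊕ 0≤ι (suc d)) gap ⟩
    ι 3 * ι (suc d)              ≤⟨ *-monoˡ-≤-0≤ (ι 3) (0≤ι 3) (ι≤weight (suc d)) ⟩
    ι 3 * ι 3 ^ d                ∎
    where
    open ≤-Reasoning
    gap : ι 3 * ι (suc d) ≡ 1ℚ + ι (suc d) + (ι d + ι (suc d))
    gap = trans (cong (ι 3 *_) (ι-+ 1 d)) (trans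
      (solve 1 (λ d → con (ι 3) :* (con 1ℚ :+ d) := con 1ℚ :+ (con 1ℚ :+ d) :+ (d :+ (con 1ℚ :+ d))) refl (ι d))
      (cong (λ e → 1ℚ + e + (ι d + e)) (sym (ι-+ 1 d))))

  -- Base 3 makes every hit cost an unsatisfied edge at least ⅔ of its weight: exactly ⅔ while more
  -- elements are missing, and everything when the last one is supplied.
  weight-pred : ∀ d → weight (ℕ.pred d) ≤ (1ℚ - ⅔) * weight d
  weight-pred zero          = ≤-refl
  weight-pred (suc zero)    = toWitness {a? = 0ℚ ≤? (1ℚ - ⅔) * 1ℚ} tt
  weight-pred (suc (suc d)) = ≤-reflexive
    (solve 1 (λ t → t := (con 1ℚ :- con ⅔) :* (con (ι 3) :* t)) refl (ι 3 ^ d))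

  potential : ∀ {n} → ℕ → List (Subset n) → (Fin n → ℕ) → ℚ
  potential f []       A = 0ℚ
  potential f (F ∷ Es) A = weight (f ℕ.∸ sumℕ-over F A) + potential f Es A

  deficit≤potential : ∀ {n} f (Es : List (Subset n)) A → ι (deficit f Es A) ≤ potential f Es A
  deficit≤potential f []       A = ≤-refl
  deficit≤potential f (F ∷ Es) A = ≤-trans
    (≤-reflexive (ι-+ (f ℕ.∸ sumℕ-over F A) (deficit f Es A)))
    (+-mono-≤ (ι≤weight (f ℕ.∸ sumℕ-over F A)) (deficit≤potential f Es A))

  -- One summand of the average, multiplied by u = w x. The conditional in the loss term is chosen
  -- so that summing over `x` yields `sum-over F w`.
  weight-add : ∀ {n} f (F : Subset n) A x u → 0ℚ ≤ u →
    u * weight (f ℕ.∸ sumℕ-over F (add 1 x A))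
      + ⅔ * weight (f ℕ.∸ sumℕ-over F A) * (if does (x ∈? F) then u else 0ℚ)
    ≤ u * weight (f ℕ.∸ sumℕ-over F A)
  weight-add f F A x u 0≤u = subst
    (λ s → u * weight (f ℕ.∸ s) + ⅔ * v * (if does (x ∈? F) then u else 0ℚ) ≤ u * v)
    (sym (sumℕ-over-add F 1 x A)) (split (does (x ∈? F)))
    where
    s : ℕ
    s = sumℕ-over F A
    v : ℚ
    v = weight (f ℕ.∸ s)
    drop : weight (f ℕ.∸ suc s) ≤ (1ℚ - ⅔) * v
    drop = subst (λ d → weight d ≤ (1ℚ - ⅔) * v) (ℕ.pred[m∸n]≡m∸[1+n] f s) (weight-pred (f ℕ.∸ s))
    split : ∀ b → u * weight (f ℕ.∸ ((if b then 1 else 0) ℕ.+ s)) + ⅔ * v * (if b then u else 0ℚ) ≤ u * v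
    split false = ≤-reflexive (trans (cong (λ t → u * v + t) (*-zeroʳ (⅔ * v))) (+-identityʳ (u * v)))
    split true  = ≤-trans (+-monoˡ-≤ (⅔ * v * u) (*-monoˡ-≤-0≤ u 0≤u drop))
      (≤-reflexive (solve 3 (λ t u v → u :* ((con 1ℚ :- t) :* v) :+ t :* v :* u := u :* v) refl ⅔ u v))

  -- The average of the new potential is at most (1 - ⅔ / W) times the old one, stated without
  -- division. On average an edge of weight v loses ⅔ v w(F) / W, and w(F) ≥ 1.
  potential-average : ∀ {n} f (Es : List (Subset n)) A (w : Fin n → ℚ) → (∀ x → 0ℚ ≤ w x) →
    All (λ F → 1ℚ ≤ sum-over F w) Es →
    sum (λ x → w x * potential f Es (add 1 x A)) + ⅔ * potential f Es A ≤ sum w * potential f Es A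
  potential-average f [] A w 0≤w [] = ≤-reflexive (trans
    (cong (_+ ⅔ * 0ℚ) (sym (*-distribʳ-sum 0ℚ w)))
    (+-identityʳ (sum w * 0ℚ)))
  potential-average f (F ∷ Es) A w 0≤w (1≤F ∷ covers) = begin
    sum (λ x → w x * (a x + b x)) + ⅔ * (v + Φ)
      ≡⟨ cong (_+ ⅔ * (v + Φ)) (trans (sum-cong-≗ (λ x → *-distribˡ-+ (w x) (a x) (b x)))
           (∑-distrib-+ (λ x → w x * a x) (λ x → w x * b x))) ⟩
    sum (λ x → w x * a x) + sum (λ x → w x * b x) + ⅔ * (v + Φ)
      ≤⟨ ≤-by-gap _ (p≤q⇒0≤q-p edge ⊕ p≤q⇒0≤q-p (potential-average f Es A w 0≤w covers)
                      ⊕ toWitness {a? = 0ℚ ≤? ⅔} tt ⊗ 0≤weight (f ℕ.∸ sumℕ-over F A) ⊗ p≤q⇒0≤q-p 1≤F)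
           (solve 7 (λ X Y v Φ W S t → W :* (v :+ Φ) := X :+ Y :+ t :* (v :+ Φ)
             :+ (W :* v :- (X :+ t :* v :* S) :+ (W :* Φ :- (Y :+ t :* Φ)) :+ t :* v :* (S :- con 1ℚ)))
             refl (sum (λ x → w x * a x)) (sum (λ x → w x * b x)) v Φ (sum w) (sum-over F w) ⅔) ⟩
    sum w * (v + Φ) ∎
    where
    open ≤-Reasoning
    a b : Fin _ → ℚ
    a x = weight (f ℕ.∸ sumℕ-over F (add 1 x A))
    b x = potential f Es (add 1 x A)
    v Φ : ℚ
    v = weight (f ℕ.∸ sumℕ-over F A)
    Φ = potential f Es A
    w∣F : Fin _ → ℚ
    w∣F x = if does (x ∈? F) then w x else 0ℚ
    edge : sum (λ x → w x * a x) + ⅔ * v * sum-over F w ≤ sum w * v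
    edge = begin
      sum (λ x → w x * a x) + ⅔ * v * sum-over F w
        ≡⟨ cong (λ t → sum (λ x → w x * a x) + t) (*-distribˡ-sum (⅔ * v) w∣F) ⟩
      sum (λ x → w x * a x) + sum (λ x → ⅔ * v * w∣F x)
        ≡⟨ ∑-distrib-+ (λ x → w x * a x) (λ x → ⅔ * v * w∣F x) ⟨
      sum (λ x → w x * a x + ⅔ * v * w∣F x)
        ≤⟨ sum-mono (λ x → weight-add f F A x (w x) (0≤w x)) ⟩
      sum (λ x → w x * v)
        ≡⟨ *-distribʳ-sum v w ⟨
      sum w * v ∎

  potential-∅ : ∀ {n} f (Es : List (Subset n)) →
    potential f Es (λ _ → 0) ≡ ι (length Es) * weight f
  potential-∅ f []       = sym (*-zeroˡ (weight f))
  potential-∅ f (F ∷ Es) = begin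
    weight (f ℕ.∸ sumℕ-over F (λ _ → 0)) + potential f Es (λ _ → 0)
      ≡⟨ cong₂ (λ s t → weight (f ℕ.∸ s) + t) (sumℕ-over-0 F) (potential-∅ f Es) ⟩
    weight f + ι (length Es) * weight f
      ≡⟨ solve 2 (λ v l → v :+ l :* v := (con 1ℚ :+ l) :* v) refl (weight f) (ι (length Es)) ⟩
    (1ℚ + ι (length Es)) * weight f
      ≡⟨ cong (_* weight f) (ι-+ 1 (length Es)) ⟨
    ι (suc (length Es)) * weight f ∎
    where open ≡-Reasoning

  -- Double counting and the greedy sequence.

  filter-∷ : ∀ {n} (x : Fin n) F Es → filter (x ∈?_) (F ∷ Es)
    ≡ (if does (x ∈? F) then F ∷ filter (x ∈?_) Es else filter (x ∈?_) Es)
  filter-∷ x F Es with does (x ∈? F)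
  ... | true  = refl
  ... | false = refl

  -- Each further edge `F` adds w(F) ≥ 1 to the weighted sum of degrees.
  double-count : ∀ {n} (Es : List (Subset n)) (w : Fin n → ℚ) →
    All (λ F → 1ℚ ≤ sum-over F w) Es →
    ι (length Es) ≤ sum (λ x → w x * ι (length (filter (x ∈?_) Es)))
  double-count [] w [] = ≤-reflexive (trans (sym (*-zeroʳ (sum w))) (*-distribʳ-sum 0ℚ w))
  double-count (F ∷ Es) w (1≤F ∷ covers) = begin
    ι (suc (length Es))
      ≡⟨ ι-+ 1 (length Es) ⟩
    1ℚ + ι (length Es)
      ≤⟨ +-mono-≤ 1≤F (double-count Es w covers) ⟩
    sum-over F w + sum (λ x → w x * ι (length (filter (x ∈?_) Es)))
      ≡⟨ ∑-distrib-+ (λ x → if does (x ∈? F) then w x else 0ℚ) _ ⟨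
    sum (λ x → (if does (x ∈? F) then w x else 0ℚ) + w x * ι (length (filter (x ∈?_) Es)))
      ≡⟨ sum-cong-≗ (λ x → trans (split (w x) (does (x ∈? F)) (filter (x ∈?_) Es))
           (cong (λ Gs → w x * ι (length Gs)) (sym (filter-∷ x F Es)))) ⟩
    sum (λ x → w x * ι (length (filter (x ∈?_) (F ∷ Es)))) ∎
    where
    open ≤-Reasoning
    split : ∀ u b Gs → (if b then u else 0ℚ) + u * ι (length Gs) ≡ u * ι (length (if b then F ∷ Gs else Gs))
    split u false Gs = +-identityˡ (u * ι (length Gs))
    split u true  Gs = trans (solve 2 (λ u l → u :+ u :* l := u :* (con 1ℚ :+ l)) refl u (ι (length Gs)))
      (cong (u *_) (sym (ι-+ 1 (length Gs))))

  length-edges≤ : ∀ {n} (H : Hypergraph n) (w : Fin n → ℚ) → (∀ x → 0ℚ ≤ w x) →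
    All (λ F → 1ℚ ≤ sum-over F w) (edges H) → ι (length (edges H)) ≤ sum w * ι (maxDegree H)
  length-edges≤ H w 0≤w covers = ≤-trans (double-count (edges H) w covers)
    (≤-trans (sum-mono (λ x → *-monoˡ-≤-0≤ (w x) (0≤w x) (ι-mono-≤ (≤maximum (degree H) x))))
      (≤-reflexive (sym (*-distribʳ-sum (ι (maxDegree H)) w))))

  -- Each round adds the vertex found by `averaging`; by `potential-average` this costs the
  -- potential a factor 1 - p with p = ⅔ / W, where p is specified by p W = ⅔.
  greedy : ∀ {n} f (Es : List (Subset n)) (w : Fin n → ℚ) → Fin n → (∀ x → 0ℚ ≤ w x) →
    All (λ F → 1ℚ ≤ sum-over F w) Es → 0ℚ < sum w →
    ∀ p → p * sum w ≡ ⅔ → p ≤ 1ℚ →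
    ∀ m → ∃[ A ] sumℕ A ≡ m × potential f Es A ≤ (1ℚ - p) ^ m * potential f Es (λ _ → 0)
  greedy {n} f Es w x₀ 0≤w covers 0<W p pW≡⅔ p≤1 zero =
    (λ _ → 0) , sumℕ-zero n , ≤-reflexive (sym (*-identityˡ (potential f Es (λ _ → 0))))
  greedy f Es w x₀ 0≤w covers 0<W p pW≡⅔ p≤1 (suc m) =
    let A , sumA≡m , bound = greedy f Es w x₀ 0≤w covers 0<W p pW≡⅔ p≤1 m
        x , φx≤ = averaging x₀ w (λ x → potential f Es (add 1 x A)) 0≤w
    in add 1 x A , trans (sumℕ-add 1 x A) (cong suc sumA≡m)
     , ≤-trans
         (*-cancelʳ-≤-pos (sum w) {{positive 0<W}} (≤-trans φx≤
           (combine (sum (λ x → w x * potential f Es (add 1 x A))) (potential f Es A)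
             (potential-average f Es A w 0≤w covers))))
         (≤-trans (*-monoˡ-≤-0≤ (1ℚ - p) (p≤q⇒0≤q-p p≤1) bound)
           (≤-reflexive (sym (*-assoc (1ℚ - p) ((1ℚ - p) ^ m) (potential f Es (λ _ → 0))))))
    where
    combine : ∀ S Φ → S + ⅔ * Φ ≤ sum w * Φ → S ≤ (1ℚ - p) * Φ * sum w
    combine S Φ h = ≤-by-gap _ (p≤q⇒0≤q-p h)
      (trans (solve 3 (λ p Φ W → (con 1ℚ :- p) :* Φ :* W := W :* Φ :- (p :* W) :* Φ) refl p Φ (sum w))
        (trans (cong (λ t → sum w * Φ - t * Φ) pW≡⅔)
          (solve 4 (λ S t Φ W → W :* Φ :- t :* Φ := S :+ (W :* Φ :- (S :+ t :* Φ))) refl S ⅔ Φ (sum w))))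

  -- A step of the greedy sequence is cut into q equal parts of size z: the bound at m q + a is a
  -- convex combination of those for m and m + 1, by Bernoulli's inequality.
  interpolate : ∀ t Φ z q .{{_ : ℕ.NonZero q}} → 0ℚ ≤ Φ → 0ℚ ≤ z → z ≤ 1ℚ → ι q * z ≤ 1ℚ →
    (∀ m → t ≤ ι m + (1ℚ - ι q * z) ^ m * Φ) →
    ∀ K → ι q * t ≤ ι K + ι q * Φ * (1ℚ - z) ^ K
  interpolate t Φ z q 0≤Φ 0≤z z≤1 qz≤1 t≤ K = begin
    ι q * t
      -- With K = q m + a, the bound at m gets weight q - a and the bound at m + 1 weight a; the two
      -- potential terms add up to q Φ P (1 - a z).
      ≤⟨ ≤-by-gap _ (p≤q⇒0≤q-p (ι-mono-≤ (ℕ.<⇒≤ (ℕ.m%n<n K q))) ⊗ p≤q⇒0≤q-p (t≤ m)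
                      ⊕ 0≤ι a ⊗ p≤q⇒0≤q-p t≤′)
           (solve 7 (λ t q a m z P Φ →
             q :* m :+ a :+ q :* Φ :* (P :* (con 1ℚ :- a :* z))
             := q :* t :+ ((q :- a) :* (m :+ P :* Φ :- t)
               :+ a :* (con 1ℚ :+ m :+ (con 1ℚ :- q :* z) :* P :* Φ :- t)))
             refl t (ι q) (ι a) (ι m) z P Φ) ⟩
    ι q * ι m + ι a + ι q * Φ * (P * (1ℚ - ι a * z))
      -- Bernoulli enters twice: for the a leftover parts, and for the q parts of each of the m
      -- whole steps.
      ≤⟨ +-monoʳ-≤ (ι q * ι m + ι a) (*-monoˡ-≤-0≤ (ι q * Φ) (0≤ι q ⊗ 0≤Φ)
           (≤-trans (*-monoˡ-≤-0≤ P 0≤P (bernoulli a 0≤z z≤1))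
             (*-monoʳ-≤-0≤ ((1ℚ - z) ^ a) (0≤^ a (p≤q⇒0≤q-p z≤1))
               (^-mono-≤ m (p≤q⇒0≤q-p qz≤1) (bernoulli q 0≤z z≤1))))) ⟩
    ι q * ι m + ι a + ι q * Φ * (((1ℚ - z) ^ q) ^ m * (1ℚ - z) ^ a)
      ≡⟨ cong₂ (λ k r → k + ι q * Φ * r) K≡ power ⟩
    ι K + ι q * Φ * (1ℚ - z) ^ K ∎
    where
    open ≤-Reasoning
    m a : ℕ
    m = K ℕ./ q
    a = K ℕ.% q
    P : ℚ
    P = (1ℚ - ι q * z) ^ m
    0≤P : 0ℚ ≤ P
    0≤P = 0≤^ m (p≤q⇒0≤q-p qz≤1)
    t≤′ : t ≤ 1ℚ + ι m + (1ℚ - ι q * z) * P * Φ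
    t≤′ = subst (λ k → t ≤ k + (1ℚ - ι q * z) * P * Φ) (ι-+ 1 m) (t≤ (suc m))
    division : q ℕ.* m ℕ.+ a ≡ K
    division = trans (ℕ.+-comm (q ℕ.* m) a)
      (trans (cong (a ℕ.+_) (ℕ.*-comm q m)) (sym (ℕ.m≡m%n+[m/n]*n K q)))
    K≡ : ι q * ι m + ι a ≡ ι K
    K≡ = trans (cong (_+ ι a) (sym (ι-* q m))) (trans (sym (ι-+ (q ℕ.* m) a)) (cong ι division))
    power : ((1ℚ - z) ^ q) ^ m * (1ℚ - z) ^ a ≡ (1ℚ - z) ^ K
    power = trans (cong (_* (1ℚ - z) ^ a) (^-assocʳ (1ℚ - z) q m))
      (trans (sym (^-homo-* (1ℚ - z) (q ℕ.* m) a)) (cong ((1ℚ - z) ^_) division))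

  -- Choosing the number of steps.

  exp-11/10 : ι 3 ≤ exp 6 (+ 11 / 10)
  -- Six terms are the fewest that suffice: the sum is about 3.0013, and with five terms about
  -- 2.988.
  exp-11/10 = toWitness {a? = ι 3 ≤? exp 6 (+ 11 / 10)} tt

  -- Of the k f small steps, k are spent on each factor 3: as k z ≥ 11/10, they bring it down to at
  -- most 1.
  3^*≤1 : ∀ {z} k f → 0ℚ ≤ z → z ≤ 1ℚ → + 11 / 10 ≤ ι k * z → ι 3 ^ f * (1ℚ - z) ^ (k ℕ.* f) ≤ 1ℚ
  3^*≤1 {z} k f 0≤z z≤1 1·1≤kz = begin
    ι 3 ^ f * (1ℚ - z) ^ (k ℕ.* f)  ≡⟨ cong (ι 3 ^ f *_) (^-assocʳ (1ℚ - z) k f) ⟨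
    ι 3 ^ f * ((1ℚ - z) ^ k) ^ f    ≡⟨ ^-distrib-* (ι 3) ((1ℚ - z) ^ k) f ⟨
    (ι 3 * (1ℚ - z) ^ k) ^ f        ≤⟨ ^≤1 f (0≤ι 3 ⊗ 0≤r) (≤-trans (*-monoʳ-≤-0≤ ((1ℚ - z) ^ k) 0≤r 3≤) (exp*[1-z]^≤1 6 k 0≤z z≤1)) ⟩
    1ℚ                              ∎
    where
    open ≤-Reasoning
    0≤r : 0ℚ ≤ (1ℚ - z) ^ k
    0≤r = 0≤^ k (p≤q⇒0≤q-p z≤1)
    3≤ : ι 3 ≤ exp 6 (ι k * z)
    3≤ = ≤-trans exp-11/10 (exp-mono-≤ 6 (nonNegative⁻¹ (+ 11 / 10)) 1·1≤kz)

  -- Stands for Δ ≤ (3/2) e^M, as e^M is the infimum of (1 − z)⁻ᵏ over kz ≥ M.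
  ExpBound : ℕ → ℚ → Set
  ExpBound Δ M = ∀ k z → 0ℚ ≤ z → z ≤ 1ℚ → M ≤ ι k * z → ι Δ * (1ℚ - z) ^ k ≤ + 3 / 2

  -- The fold number is `suc f`, so the initial weight of an edge is 3^f. The number of small steps
  -- is K = l + k f: the l steps, with l z about M, reduce Δ to at most 3/2, and the k f steps, with
  -- k z about 11/10, cancel 3^f.
  optimise : ∀ (Δ f q : ℕ) .{{_ : ℕ.NonZero q}} t Φ z M W → ExpBound Δ M → ι (suc f) ≤ M →
    0ℚ ≤ W → 0ℚ < z → z ≤ 1ℚ → ι (suc f) * z ≤ + 1 / 10 → ι q * z * W ≡ ⅔ → Φ ≤ W * ι Δ * ι 3 ^ f →
    (∀ K → ι q * t ≤ ι K + ι q * Φ * (1ℚ - z) ^ K) → t ≤ + 63 / 20 * (W * M)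
  optimise Δ f q t Φ z M W Δ≤ f≤M 0≤W 0<z z≤1 fz≤ qzW≡ Φ≤ t≤ =
    let k , 1·1≤kz , kz≤ = roundUp (+ 11 / 10) z (nonNegative⁻¹ (+ 11 / 10)) 0<z
        l , M≤lz , lz≤ = roundUp M z (≤-trans (0≤ι (suc f)) f≤M) 0<z
    in conclude k l 1·1≤kz kz≤ M≤lz lz≤
    where
    0≤z : 0ℚ ≤ z
    0≤z = <⇒≤ 0<z
    -- The leftover potential contributes 1 and the rounding (1 + f) z ≤ 1/10, together just the
    -- 11/10 that completes (11/10) f to (11/10)(1 + f) ≤ (11/10) M. Hence T ≤ (3/2) W (21/10) M,
    -- and 63/20 = (3/2)(21/10).
    linear : ∀ T R W kz lz f M z → 0ℚ ≤ W → 0ℚ ≤ f → ⅔ * T ≤ W * (lz + f * kz) + ⅔ * R →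
      kz ≤ + 11 / 10 + z → lz ≤ M + z → (1ℚ + f) * z ≤ + 1 / 10 → 1ℚ + f ≤ M → R ≤ W * (+ 3 / 2) →
      T ≤ + 63 / 20 * (W * M)
    linear T R W kz lz f M z 0≤W 0≤f h kz≤ lz≤ fz≤ f≤M R≤ = ≤-by-gap _
      (nonNegative⁻¹ (+ 3 / 2) ⊗ (p≤q⇒0≤q-p h ⊕ 0≤W ⊗ (p≤q⇒0≤q-p lz≤ ⊕ 0≤f ⊗ p≤q⇒0≤q-p kz≤
        ⊕ p≤q⇒0≤q-p fz≤ ⊕ nonNegative⁻¹ (+ 11 / 10) ⊗ p≤q⇒0≤q-p f≤M) ⊕ nonNegative⁻¹ ⅔ ⊗ p≤q⇒0≤q-p R≤))
      (solve 8 (λ T R W kz lz f M z →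
        con (+ 63 / 20) :* (W :* M) := T :+ con (+ 3 / 2) :* (
          (W :* (lz :+ f :* kz) :+ con ⅔ :* R :- con ⅔ :* T)
          :+ W :* (M :+ z :- lz :+ f :* (con (+ 11 / 10) :+ z :- kz) :+ (con (+ 1 / 10) :- (con 1ℚ :+ f) :* z)
            :+ con (+ 11 / 10) :* (M :- (con 1ℚ :+ f)))
          :+ con ⅔ :* (W :* con (+ 3 / 2) :- R)))
        refl T R W kz lz f M z)
    conclude : ∀ k l → + 11 / 10 ≤ ι k * z → ι k * z ≤ + 11 / 10 + z →
      M ≤ ι l * z → ι l * z ≤ M + z → t ≤ + 63 / 20 * (W * M)
    conclude k l 1·1≤kz kz≤ M≤lz lz≤ = linear t (Φ * r) W (ι k * z) (ι l * z) (ι f) M z 0≤W (0≤ι f)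
      scaled kz≤ lz≤ (subst (λ g → g * z ≤ + 1 / 10) (ι-+ 1 f) fz≤) (subst (_≤ M) (ι-+ 1 f) f≤M) Φr≤
      where
      open ≤-Reasoning
      K : ℕ
      K = l ℕ.+ k ℕ.* f
      r : ℚ
      r = (1ℚ - z) ^ K
      0≤1-z : 0ℚ ≤ 1ℚ - z
      0≤1-z = p≤q⇒0≤q-p z≤1
      ιK : ι K ≡ ι l + ι k * ι f
      ιK = trans (ι-+ l (k ℕ.* f)) (cong (λ x → ι l + x) (ι-* k f))
      -- Multiplication by z W turns the factor q into ⅔ and the step counts l and k into the
      -- lengths l z and k z.
      scaled : ⅔ * t ≤ W * (ι l * z + ι f * (ι k * z)) + ⅔ * (Φ * r)
      scaled = begin
        ⅔ * t
          ≡⟨ cong (_* t) qzW≡ ⟨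
        ι q * z * W * t
          ≡⟨ solve 4 (λ q z W t → q :* z :* W :* t := z :* W :* (q :* t)) refl (ι q) z W t ⟩
        z * W * (ι q * t)
          ≤⟨ *-monoˡ-≤-0≤ (z * W) (0≤z ⊗ 0≤W) (t≤ K) ⟩
        z * W * (ι K + ι q * Φ * r)
          ≡⟨ cong (λ x → z * W * (x + ι q * Φ * r)) ιK ⟩
        z * W * (ι l + ι k * ι f + ι q * Φ * r)
          ≡⟨ solve 8 (λ z W l k f q Φ r → z :* W :* (l :+ k :* f :+ q :* Φ :* r)
               := W :* (l :* z :+ f :* (k :* z)) :+ q :* z :* W :* (Φ :* r)) refl z W (ι l) (ι k) (ι f) (ι q) Φ r ⟩
        W * (ι l * z + ι f * (ι k * z)) + ι q * z * W * (Φ * r)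
          ≡⟨ cong (λ x → W * (ι l * z + ι f * (ι k * z)) + x * (Φ * r)) qzW≡ ⟩
        W * (ι l * z + ι f * (ι k * z)) + ⅔ * (Φ * r) ∎
      Φr≤ : Φ * r ≤ W * (+ 3 / 2)
      Φr≤ = begin
        Φ * r
          ≤⟨ *-monoʳ-≤-0≤ r (0≤^ K 0≤1-z) Φ≤ ⟩
        W * ι Δ * ι 3 ^ f * r
          ≡⟨ cong (W * ι Δ * ι 3 ^ f *_) (^-homo-* (1ℚ - z) l (k ℕ.* f)) ⟩
        W * ι Δ * ι 3 ^ f * ((1ℚ - z) ^ l * (1ℚ - z) ^ (k ℕ.* f))
          ≡⟨ solve 5 (λ W d g a b → W :* d :* g :* (a :* b) := W :* (d :* a :* (g :* b)))
               refl W (ι Δ) (ι 3 ^ f) ((1ℚ - z) ^ l) ((1ℚ - z) ^ (k ℕ.* f)) ⟩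
        W * (ι Δ * (1ℚ - z) ^ l * (ι 3 ^ f * (1ℚ - z) ^ (k ℕ.* f)))
          ≤⟨ *-monoˡ-≤-0≤ W 0≤W (*-mono-≤-0≤ (0≤ι Δ ⊗ 0≤^ l 0≤1-z) (0≤^ f (0≤ι 3) ⊗ 0≤^ (k ℕ.* f) 0≤1-z)
               (Δ≤ l z 0≤z z≤1 M≤lz) (3^*≤1 k f 0≤z z≤1 1·1≤kz)) ⟩
        W * (+ 3 / 2 * 1ℚ)
          ≡⟨ cong (W *_) (*-identityʳ (+ 3 / 2)) ⟩
        W * (+ 3 / 2) ∎

  transversalNumber≤ : ∀ {n} (H : Hypergraph n) f {τ} → IsFoldTransversalNumber H (suc f) τ →
    ∀ M → ExpBound (maxDegree H) M → ι (suc f) ≤ M →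
    ∀ (w : Fin n → ℚ) → (∀ x → 0ℚ ≤ w x) → All (λ F → 1ℚ ≤ sum-over F w) (edges H) →
    ι τ ≤ + 63 / 20 * (sum w * M)
  transversalNumber≤ {n} H f {τ} (_ , minimal) M Δ≤ f≤M w 0≤w covers =
    optimise (maxDegree H) f q (ι τ) Φ z M W Δ≤ f≤M (<⇒≤ 0<W) 0<z z≤1 fz≤ qzW≡
      Φ≤ (interpolate (ι τ) Φ z q 0≤Φ (<⇒≤ 0<z) z≤1 qz≤1 steps)
    where
    -- Any edge supplies a vertex to start `averaging` and shows W ≥ 1, which keeps p = ⅔ / W below
    -- 1.
    anEdge : ∀ Es → Es ≢ [] → All Nonempty Es → All (λ F → 1ℚ ≤ sum-over F w) Es → Fin n × 1ℚ ≤ sum w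
    anEdge []       ≢[] _                 _          = ⊥-elim (≢[] refl)
    anEdge (F ∷ Es) ≢[] ((x , _) ∷ _) (1≤F ∷ _) = x , ≤-trans 1≤F (sum-over≤sum F 0≤w)
    W Φ : ℚ
    W = sum w
    Φ = potential (suc f) (edges H) (λ _ → 0)
    1≤W : 1ℚ ≤ W
    1≤W = proj₂ (anEdge (edges H) (edges≢[] H) (edgesNonempty H) covers)
    0<W : 0ℚ < W
    0<W = <-≤-trans (positive⁻¹ 1ℚ) 1≤W
    instance
      W-pos : Positive W
      W-pos = positive 0<W
      W-nonZero : NonZero W
      W-nonZero = pos⇒nonZero W
      1/W-pos : Positive (1/ W)
      1/W-pos = 1/pos⇒pos W
    q : ℕ
    -- With this many parts per greedy step, (f + 1) z = p / 10 ≤ 1/10, the allowance for rounding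
    -- in `optimise`.
    q = 10 ℕ.* suc f
    p z : ℚ
    p = ⅔ * 1/ W
    z = p * (+ 1 / q)
    instance
      1/q-pos : Positive (+ 1 / q)
      1/q-pos = normalize-pos 1 q
      p-pos : Positive p
      p-pos = pos*pos⇒pos ⅔ (1/ W)
    pW≡⅔ : p * W ≡ ⅔
    pW≡⅔ = trans (*-assoc ⅔ (1/ W) W) (trans (cong (⅔ *_) (*-inverseˡ W)) (*-identityʳ ⅔))
    p≤1 : p ≤ 1ℚ
    p≤1 = begin
      p       ≡⟨ *-identityʳ p ⟨
      p * 1ℚ  ≤⟨ *-monoˡ-≤-0≤ p (<⇒≤ (positive⁻¹ p)) 1≤W ⟩
      p * W   ≡⟨ pW≡⅔ ⟩
      ⅔       ≤⟨ toWitness {a? = ⅔ ≤? 1ℚ} tt ⟩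
      1ℚ      ∎
      where open ≤-Reasoning
    qz≡p : ι q * z ≡ p
    qz≡p = trans (solve 3 (λ q p r → q :* (p :* r) := p :* (q :* r)) refl (ι q) p (+ 1 / q))
      (trans (cong (p *_) (ι-inverse q)) (*-identityʳ p))
    qz≤1 : ι q * z ≤ 1ℚ
    qz≤1 = subst (_≤ 1ℚ) (sym qz≡p) p≤1
    qzW≡ : ι q * z * W ≡ ⅔
    qzW≡ = trans (cong (_* W) qz≡p) pW≡⅔
    0<z : 0ℚ < z
    0<z = positive⁻¹ z {{pos*pos⇒pos p (+ 1 / q)}}
    z≤1 : z ≤ 1ℚ
    z≤1 = ≤-trans (≤-trans (≤-reflexive (sym (*-identityˡ z)))
      (*-monoʳ-≤-0≤ z (<⇒≤ 0<z) (ι-mono-≤ {1} {q} (ℕ.s≤s ℕ.z≤n)))) qz≤1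
    fz≤ : ι (suc f) * z ≤ + 1 / 10
    fz≤ = ≤-trans (≤-reflexive (trans
        (solve 2 (λ g z → g :* z := con (+ 1 / 10) :* (con (ι 10) :* g :* z)) refl (ι (suc f)) z)
        (cong (λ x → + 1 / 10 * (x * z)) (sym (ι-* 10 (suc f))))))
      (*-monoˡ-≤-0≤ (+ 1 / 10) (nonNegative⁻¹ (+ 1 / 10)) qz≤1)
    0≤Φ : 0ℚ ≤ Φ
    0≤Φ = subst (0ℚ ≤_) (sym (potential-∅ (suc f) (edges H))) (0≤ι (length (edges H)) ⊗ 0≤weight (suc f))
    Φ≤ : Φ ≤ W * ι (maxDegree H) * ι 3 ^ f
    Φ≤ = ≤-trans (≤-reflexive (potential-∅ (suc f) (edges H)))
      (*-monoʳ-≤-0≤ (ι 3 ^ f) (0≤^ f (0≤ι 3)) (length-edges≤ H w 0≤w covers))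
    τ≤ : ∀ A → ι τ ≤ ι (sumℕ A) + potential (suc f) (edges H) A
    τ≤ A =
      let B , _ , sumB , transversal = repair (suc f) (edges H) A (edgesNonempty H)
          open ≤-Reasoning
      in begin
        ι τ                                             ≤⟨ ι-mono-≤ (ℕ.≤-trans (minimal B transversal) (ℕ.≤-reflexive sumB)) ⟩
        ι (deficit (suc f) (edges H) A ℕ.+ sumℕ A)      ≡⟨ ι-+ (deficit (suc f) (edges H) A) (sumℕ A) ⟩
        ι (deficit (suc f) (edges H) A) + ι (sumℕ A)    ≡⟨ +-comm (ι (deficit (suc f) (edges H) A)) (ι (sumℕ A)) ⟩
        ι (sumℕ A) + ι (deficit (suc f) (edges H) A)    ≤⟨ +-monoʳ-≤ (ι (sumℕ A)) (deficit≤potential (suc f) (edges H) A) ⟩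
        ι (sumℕ A) + potential (suc f) (edges H) A      ∎
    steps : ∀ m → ι τ ≤ ι m + (1ℚ - ι q * z) ^ m * Φ
    steps m =
      let A , sumA , bound = greedy (suc f) (edges H) w
            (proj₁ (anEdge (edges H) (edges≢[] H) (edgesNonempty H) covers)) 0≤w covers 0<W p pW≡⅔ p≤1 m
      in ≤-trans (τ≤ A) (+-mono-≤ (≤-reflexive (cong ι sumA))
        (subst (λ r → potential (suc f) (edges H) A ≤ (1ℚ - r) ^ m * Φ) (sym qz≡p) bound))

-- From the real logarithm to rational bounds on Δ.

module RealTransversals where
  open Defs using (ℝ; seq; cauchy; fromℚ; fromℕ; expPartialSum; IsLn; Hypergraph; edges; edgesNonempty;
    maxDegree; sumℝ; sumℝ-over; IsFoldTransversalNumber; IsFractionalTransversal;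
    IsFractionalTransversalNumber)
  open import Data.Rational.Base
  open import Data.Rational.Properties
  open import Data.Rational.Solver using (module +-*-Solver)
  open +-*-Solver hiding (_:^_)
  open import Algebra.Bundles using (CommutativeRing)
  open CommutativeRing +-*-commutativeRing using (semiring)
  open import Algebra.Properties.Semiring.Sum semiring using (sum; sum-cong-≗; ∑-distrib-+)
  open Arithmetic
  open Exponential
  open Transversals

  seq-^ : ∀ y n j → seq (y Defs.^ n) j ≡ seq y j ^ n
  seq-^ y zero    j = refl
  seq-^ y (suc n) j = cong (seq y j *_) (seq-^ y n j)

  seq-exp : ∀ y n j → seq (expPartialSum y n) j ≡ exp n (seq y j)
  seq-exp y zero    j = refl
  seq-exp y (suc n) j = cong₂ (λ s t → s + t * Defs.1/ n !) (seq-exp y n j) (seq-^ y n j)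

  -- For small degrees the two-term sum 1 + M ≥ 2 already bounds Δ, whatever the approximation of
  -- the logarithm.
  ExpBound-≤2 : ∀ {Δ M} → Δ ℕ.≤ 2 → 1ℚ ≤ M → ExpBound Δ M
  ExpBound-≤2 {Δ} Δ≤2 1≤M k z 0≤z z≤1 M≤kz = begin
    ι Δ * (1ℚ - z) ^ k             ≤⟨ *-monoʳ-≤-0≤ ((1ℚ - z) ^ k) (0≤^ k (p≤q⇒0≤q-p z≤1))
      (≤-trans (ι-mono-≤ Δ≤2) (exp-mono-≤ 2 0≤1 (≤-trans 1≤M M≤kz))) ⟩
    exp 2 (ι k * z) * (1ℚ - z) ^ k ≤⟨ exp*[1-z]^≤1 2 k 0≤z z≤1 ⟩
    1ℚ                             ≤⟨ toWitness {a? = 1ℚ ≤? + 3 / 2} tt ⟩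
    + 3 / 2                        ∎
    where open ≤-Reasoning

  -- The partial sum times the power is at most 1 and the error ½ stays at most ½, which gives the
  -- 3/2 of `ExpBound`.
  ExpBound-exp : ∀ n {Δ y M} → 0ℚ ≤ y → y ≤ M → ι Δ ≤ exp n y + ½ → ExpBound Δ M
  ExpBound-exp n {Δ} {y} 0≤y y≤M Δ≤ k z 0≤z z≤1 M≤kz = begin
    ι Δ * r                        ≤⟨ *-monoʳ-≤-0≤ r (0≤^ k 0≤1-z)
      (≤-trans Δ≤ (+-monoˡ-≤ ½ (exp-mono-≤ n 0≤y (≤-trans y≤M M≤kz)))) ⟩
    (exp n (ι k * z) + ½) * r      ≡⟨ *-distribʳ-+ r (exp n (ι k * z)) ½ ⟩
    exp n (ι k * z) * r + ½ * r    ≤⟨ +-mono-≤ (exp*[1-z]^≤1 n k 0≤z z≤1)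
      (*-monoˡ-≤-0≤ ½ (nonNegative⁻¹ ½) (^≤1 k 0≤1-z
        (≤-by-gap z 0≤z (solve 1 (λ z → con 1ℚ := con 1ℚ :- z :+ z) refl z)))) ⟩
    1ℚ + ½ * 1ℚ                    ∎
    where
    open ≤-Reasoning
    r : ℚ
    r = (1ℚ - z) ^ k
    0≤1-z : 0ℚ ≤ 1ℚ - z
    0≤1-z = p≤q⇒0≤q-p z≤1

  -- A fixed partial sum at the rational approximations of ln Δ eventually reaches Δ - ½.
  -- Approximations that are not positive need care, since `exp-mono-≤` covers only nonnegative
  -- arguments.
  ExpBound-ln : ∀ {Δ f y} → 1 ℕ.≤ f → IsLn (fromℕ Δ) y →
    ∃[ N ] (∀ j → N ℕ.≤ j → ExpBound Δ (seq y j ⊔ ι f))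
  ExpBound-ln {Δ} {f} {y} 1≤f isLn =
    -- The error ½ is split in two: ¼ for truncating the series and ¼ for comparing reals through
    -- their approximations.
    let N , close = isLn ¼ (positive⁻¹ ¼)
        N′ , bound = proj₂ (close (n N) (ℕ.≤-trans (ℕ.m≤m+n N N) (ℕ.m≤n+m (N ℕ.+ N) 2))) ¼ (positive⁻¹ ¼)
    in N′ , λ j N′≤j → cases N j (split (exp (n N) (seq y j))
         (subst (λ e → ι Δ ≤ e + ¼ + ¼) (seq-exp y (n N) j) (bound j N′≤j)))
         (Δ ℕ.≤? 2) (≤-total 0ℚ (seq y j))
    where
    ¼ : ℚ
    ¼ = + 1 / 4
    -- Even, as `exp-neg≤2` demands, and at least `N`, so that the convergence bound applies.
    n : ℕ → ℕ
    n N = suc (suc (N ℕ.+ N))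
    split : ∀ e → ι Δ ≤ e + ¼ + ¼ → ι Δ ≤ e + ½
    split e = subst (ι Δ ≤_) (+-assoc e ¼ ¼)
    cases : ∀ N j → ι Δ ≤ exp (n N) (seq y j) + ½ → Dec (Δ ℕ.≤ 2) →
      0ℚ ≤ seq y j ⊎ seq y j ≤ 0ℚ → ExpBound Δ (seq y j ⊔ ι f)
    cases N j Δ≤ (yes Δ≤2) _           = ExpBound-≤2 {Δ} Δ≤2 (≤-trans (ι-mono-≤ 1≤f) (p≤q⊔p (seq y j) (ι f)))
    cases N j Δ≤ (no Δ≰2)  (inj₁ 0≤yⱼ) = ExpBound-exp (n N) {Δ} 0≤yⱼ (p≤p⊔q (seq y j) (ι f)) Δ≤
    -- Contradictory: at a nonpositive argument the partial sum is at most 2, so 3 ≤ Δ ≤ 2 + ½ would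
    -- follow.
    cases N j Δ≤ (no Δ≰2)  (inj₂ yⱼ≤0) = ⊥-elim (3≰2+½ (≤-trans (ι-mono-≤ (ℕ.≰⇒> Δ≰2))
      (≤-trans Δ≤ (+-monoˡ-≤ ½ (subst (λ x → exp (n N) x ≤ 1ℚ + 1ℚ) (neg-involutive (seq y j))
        (exp-neg≤2 N (- seq y j) (neg-antimono-≤ yⱼ≤0)))))))
      where
      neg-involutive : ∀ p → - (- p) ≡ p
      neg-involutive = solve 1 (λ p → :- (:- p) := p) refl
      3≰2+½ : ι 3 ≰ 1ℚ + 1ℚ + ½
      3≰2+½ = toWitnessFalse {a? = ι 3 ≤? 1ℚ + 1ℚ + ½} tt

  -- Rational approximation of real fractional transversals.

  Eventually : (ℕ → Set) → Set
  Eventually P = ∃[ N ] (∀ i → N ℕ.≤ i → P i)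

  eventually-× : ∀ {P Q} → Eventually P → Eventually Q → Eventually (λ i → P i × Q i)
  eventually-× (M , p) (N , q) = M ℕ.⊔ N , λ i h →
    p i (ℕ.m⊔n≤o⇒m≤o M N h) , q i (ℕ.m⊔n≤o⇒n≤o M N h)

  eventually-∀ : ∀ {n} {P : Fin n → ℕ → Set} → (∀ x → Eventually (P x)) → Eventually (λ i → ∀ x → P x i)
  eventually-∀ {zero}  ev = 0 , λ _ _ ()
  eventually-∀ {suc n} ev =
    let N , h = eventually-× (ev zero) (eventually-∀ (λ x → ev (suc x)))
    in N , λ { i N≤i zero → proj₁ (h i N≤i) ; i N≤i (suc x) → proj₂ (h i N≤i) x }

  eventually-All : ∀ {A : Set} {P : A → ℕ → Set} {xs} → All (λ x → Eventually (P x)) xs →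
    Eventually (λ i → All (λ x → P x i) xs)
  eventually-All []         = 0 , λ _ _ → []
  eventually-All (ev ∷ evs) =
    let N , h = eventually-× ev (eventually-All evs)
    in N , λ i N≤i → proj₁ (h i N≤i) ∷ proj₂ (h i N≤i)

  seq-sum : ∀ {n} (w : Fin n → ℝ) i → seq (sumℝ w) i ≡ sum (λ x → seq (w x) i)
  seq-sum {zero}  w i = refl
  seq-sum {suc n} w i = cong (λ s → seq (w zero) i + s) (seq-sum (λ x → w (suc x)) i)

  seq-sum-over : ∀ {n} (F : Subset n) (w : Fin n → ℝ) i →
    seq (sumℝ-over F w) i ≡ sum-over F (λ x → seq (w x) i)
  seq-sum-over F w i = trans (seq-sum (λ x → if does (x ∈? F) then w x else Defs.0ℝ) i)
    (sum-cong-≗ (λ x → seq-if (does (x ∈? F)) (w x)))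
    where
    seq-if : ∀ b u → seq (if b then u else Defs.0ℝ) i ≡ (if b then seq u i else 0ℚ)
    seq-if true  u = refl
    seq-if false u = refl

  sum-const : ∀ n δ → sum {n} (λ _ → δ) ≡ ι n * δ
  sum-const zero    δ = sym (*-zeroˡ δ)
  sum-const (suc n) δ = trans (cong (λ s → δ + s) (sum-const n δ))
    (trans (+-comm δ (ι n * δ)) (sym (ι-suc-* n δ)))

  term≤sum : ∀ {n} {w : Fin n → ℚ} → (∀ x → 0ℚ ≤ w x) → ∀ x → w x ≤ sum w
  term≤sum {w = w} 0≤w zero    = ≤-by-gap (sum (λ y → w (suc y))) (0≤sum (λ y → 0≤w (suc y))) refl
  term≤sum {w = w} 0≤w (suc x) = ≤-trans (term≤sum (λ y → 0≤w (suc y)) x)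
    (≤-by-gap (w zero) (0≤w zero) (+-comm (w zero) (sum (λ y → w (suc y)))))

  -- The shift at a single vertex of `F` already contributes δ, and the other shifts are
  -- nonnegative.
  sum-over-+ : ∀ {n} (F : Subset n) (w : Fin n → ℚ) {δ} → 0ℚ ≤ δ → Nonempty F →
    sum-over F w + δ ≤ sum-over F (λ x → w x + δ)
  sum-over-+ F w {δ} 0≤δ (x , x∈F) = begin
    sum-over F w + δ
      ≡⟨ cong (λ b → sum-over F w + (if b then δ else 0ℚ)) (dec-true (x ∈? F) x∈F) ⟨
    sum-over F w + (if does (x ∈? F) then δ else 0ℚ)
      ≤⟨ +-monoʳ-≤ (sum-over F w) (term≤sum (λ y → 0≤if (does (y ∈? F))) x) ⟩
    sum-over F w + sum-over F (λ _ → δ)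
      ≡⟨ ∑-distrib-+ (λ y → if does (y ∈? F) then w y else 0ℚ) (λ y → if does (y ∈? F) then δ else 0ℚ) ⟨
    sum (λ y → (if does (y ∈? F) then w y else 0ℚ) + (if does (y ∈? F) then δ else 0ℚ))
      ≡⟨ sum-cong-≗ (λ y → if-+ (does (y ∈? F)) (w y)) ⟩
    sum-over F (λ y → w y + δ) ∎
    where
    open ≤-Reasoning
    0≤if : ∀ b → 0ℚ ≤ (if b then δ else 0ℚ)
    0≤if true  = 0≤δ
    0≤if false = ≤-refl
    if-+ : ∀ b u → (if b then u else 0ℚ) + (if b then δ else 0ℚ) ≡ (if b then u + δ else 0ℚ)
    if-+ true  u = refl
    if-+ false u = refl

  -- Adding δ to every weight absorbs an error of δ both in w ≥ 0 and, edges being nonempty, in w(F) ≥ 1.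
  lowerBound-real : ∀ {n} (H : Hypergraph n) b →
    (∀ (w : Fin n → ℚ) → (∀ x → 0ℚ ≤ w x) → All (λ F → 1ℚ ≤ sum-over F w) (edges H) → b ≤ sum w) →
    ∀ w → IsFractionalTransversal H w → fromℚ b Defs.≤ sumℝ w
  lowerBound-real {n} H b b≤ w (bounds , covers) ε 0<ε =
    let N , h = eventually-× (eventually-∀ (λ x → proj₁ (bounds x) δ 0<δ))
                  (eventually-All (All.map (λ h → h δ 0<δ) covers))
    in N , λ i N≤i → approximate i (proj₁ (h i N≤i)) (proj₂ (h i N≤i))
    where
    instance
      ε-pos : Positive ε
      ε-pos = positive 0<ε
      1/n-pos : Positive (+ 1 / suc n)
      1/n-pos = normalize-pos 1 (suc n)
    δ : ℚ
    -- Shifting all n weights then costs at most ε in total; the divisor n + 1 is nonzero even for n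
    -- = 0.
    δ = ε * (+ 1 / suc n)
    0<δ : 0ℚ < δ
    0<δ = positive⁻¹ δ {{pos*pos⇒pos ε (+ 1 / suc n)}}
    nδ≤ε : ι n * δ ≤ ε
    nδ≤ε = begin
      ι n * δ                          ≤⟨ *-monoʳ-≤-0≤ δ (<⇒≤ 0<δ) (ι-mono-≤ (ℕ.n≤1+n n)) ⟩
      ι (suc n) * (ε * (+ 1 / suc n))  ≡⟨ solve 3 (λ m ε r → m :* (ε :* r) := ε :* (m :* r)) refl (ι (suc n)) ε (+ 1 / suc n) ⟩
      ε * (ι (suc n) * (+ 1 / suc n))  ≡⟨ cong (ε *_) (ι-inverse (suc n)) ⟩
      ε * 1ℚ                           ≡⟨ *-identityʳ ε ⟩
      ε                                ∎
      where open ≤-Reasoning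
    approximate : ∀ i → (∀ x → 0ℚ ≤ seq (w x) i + δ) →
      All (λ F → 1ℚ ≤ seq (sumℝ-over F w) i + δ) (edges H) → b ≤ seq (sumℝ w) i + ε
    approximate i nonneg cover = begin
      b                                   ≤⟨ b≤ (λ x → seq (w x) i + δ) nonneg
        (All.zipWith (λ {F} (nonempty , 1≤) → ≤-trans 1≤
            (≤-trans (≤-reflexive (cong (_+ δ) (seq-sum-over F w i)))
              (sum-over-+ F (λ x → seq (w x) i) (<⇒≤ 0<δ) nonempty)))
          (edgesNonempty H , cover)) ⟩
      sum (λ x → seq (w x) i + δ)         ≡⟨ ∑-distrib-+ (λ x → seq (w x) i) (λ _ → δ) ⟩
      sum (λ x → seq (w x) i) + sum {n} (λ _ → δ) ≡⟨ cong₂ _+_ (sym (seq-sum w i)) (sum-const n δ) ⟩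
      seq (sumℝ w) i + ι n * δ            ≤⟨ +-monoʳ-≤ (seq (sumℝ w) i) nδ≤ε ⟩
      seq (sumℝ w) i + ε                  ∎
      where open ≤-Reasoning

  close⇒≤ : ∀ p q {ε} → ∣ p - q ∣ ≤ ε → p ≤ q + ε
  close⇒≤ p q {ε} h = ≤-by-gap _ (p≤q⇒0≤q-p (≤-trans (p≤∣p∣ (p - q)) h))
    (solve 3 (λ p q e → q :+ e := p :+ (e :- (p :- q))) refl p q ε)

  -- The greatest lower bound and the final constant.

  η : ℚ
  η = + 1 / 1050

  -- 3153/1000 = (63/20)(1 + η)
  transfer : ∀ {b M M′ s ε ε′} → 0ℚ ≤ b → 0ℚ ≤ ε′ → 1ℚ ≤ M′ → M ≤ M′ + η → M′ ≤ M + 1ℚ → b ≤ s + ε′ →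
    + 3153 / 1000 * (M + 1ℚ) * ε′ ≡ ε →
    + 63 / 20 * M * b ≤ + 3153 / 1000 * s * M′ + ε
  transfer {b} {M} {M′} {s} {ε′ = ε′} 0≤b 0≤ε′ 1≤M′ M≤ M′≤ b≤ refl = ≤-by-gap _
    -- The three summands record M ≤ M′ + η ≤ (1 + η) M′, then b ≤ s + ε′, then M′ ε′ ≤ (M + 1) ε′.
    (nonNegative⁻¹ (+ 63 / 20) ⊗ 0≤b ⊗ (p≤q⇒0≤q-p M≤ ⊕ nonNegative⁻¹ η ⊗ p≤q⇒0≤q-p 1≤M′)
      ⊕ nonNegative⁻¹ (+ 3153 / 1000) ⊗ (≤-trans 0≤1 1≤M′ ⊗ p≤q⇒0≤q-p b≤)
      ⊕ nonNegative⁻¹ (+ 3153 / 1000) ⊗ (0≤ε′ ⊗ p≤q⇒0≤q-p M′≤))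
    (solve 5 (λ b M M′ s e →
      con (+ 3153 / 1000) :* s :* M′ :+ con (+ 3153 / 1000) :* (M :+ con 1ℚ) :* e
      := con (+ 63 / 20) :* M :* b
        :+ (con (+ 63 / 20) :* b :* (M′ :+ con η :- M :+ con η :* (M′ :- con 1ℚ))
          :+ con (+ 3153 / 1000) :* (M′ :* (s :+ e :- b))
          :+ con (+ 3153 / 1000) :* (e :* (M :+ con 1ℚ :- M′))))
      refl b M M′ s ε′)

  -- With the index j of the logarithm frozen, τf divided by (63/20) M j is a rational lower bound
  -- for all fractional transversals, hence for τ*. The Cauchy property then replaces M j by M i for
  -- all large i.
  foldTransversalNumber≤ : ∀ {n} (H : Hypergraph n) f {τf} → IsFoldTransversalNumber H (suc f) τf →
    ∀ {τ* lnΔ} → IsFractionalTransversalNumber H τ* → IsLn (fromℕ (maxDegree H)) lnΔ →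
    fromℕ τf Defs.≤ fromℚ (+ 3153 / 1000) Defs.* τ* Defs.* (lnΔ Defs.⊔ fromℕ (suc f))
  foldTransversalNumber≤ H f {τf} isτf {τ*} {lnΔ} (_ , greatest) isLn ε 0<ε =
    let N₀ , expBound = ExpBound-ln {maxDegree H} {suc f} {lnΔ} (ℕ.s≤s ℕ.z≤n) isLn
        N₁ , close = cauchy lnΔ η (positive⁻¹ η)
        j = N₀ ℕ.⊔ N₁
    in conclude N₁ j (ℕ.m≤n⊔m N₀ N₁) (expBound j (ℕ.m≤m⊔n N₀ N₁)) close
    where
    M : ℕ → ℚ
    M i = seq lnΔ i ⊔ ι (suc f)
    1≤M : ∀ i → 1ℚ ≤ M i
    1≤M i = ≤-trans (ι-mono-≤ {1} {suc f} (ℕ.s≤s ℕ.z≤n)) (p≤q⊔p (seq lnΔ i) (ι (suc f)))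
    M≤M+η : ∀ i j → ∣ seq lnΔ i - seq lnΔ j ∣ ≤ η → M i ≤ M j + η
    M≤M+η i j h = ⊔-lub
      (≤-trans (close⇒≤ (seq lnΔ i) (seq lnΔ j) h) (+-monoˡ-≤ η (p≤p⊔q (seq lnΔ j) (ι (suc f)))))
      (≤-trans (p≤q⊔p (seq lnΔ j) (ι (suc f))) (≤-by-gap {M j} η (nonNegative⁻¹ η) refl))
    conclude : ∀ N₁ j → N₁ ℕ.≤ j → ExpBound (maxDegree H) (M j) →
      (∀ i j → N₁ ℕ.≤ i → N₁ ℕ.≤ j → ∣ seq lnΔ i - seq lnΔ j ∣ ≤ η) →
      Eventually (λ i → ι τf ≤ + 3153 / 1000 * seq τ* i * M i + ε)
    conclude N₁ j N₁≤j expBound close =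
      let N₂ , b≤τ* = greatest (fromℚ b) (lowerBound-real H b b≤) ε′ 0<ε′
      in N₁ ℕ.⊔ N₂ , λ i N≤i →
        let N₁≤i = ℕ.m⊔n≤o⇒m≤o N₁ N₂ N≤i
        in subst (_≤ + 3153 / 1000 * seq τ* i * M i + ε) cb≡τ
          (transfer {s = seq τ* i} 0≤b (<⇒≤ 0<ε′) (1≤M i) (M≤M+η j i (close j i N₁≤j N₁≤i))
            (≤-trans (M≤M+η i j (close i j N₁≤i N₁≤j)) (+-monoʳ-≤ (M j) (toWitness {a? = η ≤? 1ℚ} tt)))
            (b≤τ* i (ℕ.m⊔n≤o⇒n≤o N₁ N₂ N≤i)) dε′≡ε)
      where
      c d : ℚ
      c = + 63 / 20 * M j
      d = + 3153 / 1000 * (M j + 1ℚ)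
      0<M : 0ℚ < M j
      0<M = <-≤-trans (positive⁻¹ 1ℚ) (1≤M j)
      instance
        M-pos : Positive (M j)
        M-pos = positive 0<M
        M+1-pos : Positive (M j + 1ℚ)
        M+1-pos = pos+pos⇒pos (M j) 1ℚ
        c-pos : Positive c
        c-pos = pos*pos⇒pos (+ 63 / 20) (M j)
        d-pos : Positive d
        d-pos = pos*pos⇒pos (+ 3153 / 1000) (M j + 1ℚ)
        c-nonZero : NonZero c
        c-nonZero = pos⇒nonZero c
        d-nonZero : NonZero d
        d-nonZero = pos⇒nonZero d
        1/c-pos : Positive (1/ c)
        1/c-pos = 1/pos⇒pos c
        1/d-pos : Positive (1/ d)
        1/d-pos = 1/pos⇒pos d
        ε-pos : Positive ε
        ε-pos = positive 0<ε
      b ε′ : ℚ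
      -- The lower bound for τ*, chosen so that (63/20) (M j) b is exactly τf.
      b  = 1/ c * ι τf
      -- The precision for b ≤ τ*; as M i ≤ M j + 1, multiplying it by (3153/1000) (M i) gives at
      -- most ε.
      ε′ = 1/ d * ε
      0≤b : 0ℚ ≤ b
      0≤b = <⇒≤ (positive⁻¹ (1/ c)) ⊗ 0≤ι τf
      0<ε′ : 0ℚ < ε′
      0<ε′ = positive⁻¹ ε′ {{pos*pos⇒pos (1/ d) ε}}
      cancel : ∀ p .{{_ : NonZero p}} x → p * (1/ p * x) ≡ x
      cancel p x = trans (sym (*-assoc p (1/ p) x)) (trans (cong (_* x) (*-inverseʳ p)) (*-identityˡ x))
      cb≡τ : c * b ≡ ι τf
      cb≡τ = cancel c (ι τf)
      dε′≡ε : d * ε′ ≡ ε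
      dε′≡ε = cancel d ε
      b≤ : ∀ w → (∀ x → 0ℚ ≤ w x) → All (λ F → 1ℚ ≤ sum-over F w) (edges H) → b ≤ sum w
      b≤ w 0≤w covers = *-cancelˡ-≤-pos c (≤-trans (≤-reflexive cb≡τ)
        (≤-trans (transversalNumber≤ H f isτf (M j) expBound (p≤q⊔p (seq lnΔ j) (ι (suc f))) w 0≤w covers)
          (≤-reflexive (solve 3 (λ k W m → k :* (W :* m) := k :* m :* W) refl (+ 63 / 20) (sum w) (M j)))))

open import Defs
open import Data.Rational.Base using (_/_)

corollary1p2 : ∀ {n} (H : Hypergraph n) (f : ℕ) → 1 ℕ.≤ f →
    ∀ (τf : ℕ) → IsFoldTransversalNumber H f τf →
    ∀ (τ* : ℝ) → IsFractionalTransversalNumber H τ* →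
    ∀ (lnΔ : ℝ) → IsLn (fromℕ (maxDegree H)) lnΔ →
    fromℕ τf ≤ fromℚ (+ 3153 / 1000) * τ* * (lnΔ ⊔ fromℕ f)
corollary1p2 H (suc f) _ τf isτf τ* isτ* lnΔ isLn =
  RealTransversals.foldTransversalNumber≤ H f isτf {τ*} {lnΔ} isτ* isLn
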